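{- Let $p$ be a prime, $q=p^r$ with $r\geq 1$, and let $\mathbb{F}_q=\{0,\alpha_1,\dots,\alpha_{q-1}\}$ (so $\alpha_1,\dots,\alpha_{q-1}$ is a fixed enumeration of the nonzero elements). Let $n$ and $k>1$ be positive integers and let $D=p^{\lfloor\log_p(k)\rfloor+1}$. Then $$ S_{\mathbb{F}_q}(\boldsymbol{e}_{n,k}) = \sum_{j_1=0}^{D-1}\sum_{j_2=0}^{j_1}\cdots \sum_{j_{q-1}=0}^{j_{q-2}} c_{j_1,\dots,j_{q-1}}(k)\left(1+\xi_D^{ -j_1}+\cdots+\xi_D^{ -j_{q-1}}\right)^n,$$ where $$c_{j_1,\dots,j_{q-1}}(k)=\frac{1}{D^{q-1}}\sum_{b_{q-1}=0}^{D-1}\cdots \sum_{b_1=0}^{D-1} \xi_p^{\mathrm{Tr}\left(F_{k;\mathbb{F}_q}^{(p)}(b_1,\dots,b_{q-1})\right)}\sum_{(j_1',\dots,j_{q-1}')\in \mathrm{Sym}(j_1,\dots, j_{q-1})}\xi_D^{j_1'b_{q-1}+\cdots+j_{q-1}' b_1}.$$ In particular, the sequence $\{S_{\mathbb{F}_q}(\boldsymbol{e}_{n,k})\}_n$ satisfies the linear recurrence with integer coefficients whose characteristic polynomial is $$P_{q,k}(X)=\prod_{a_1=0}^{D-1}\,\prod_{0\leq a_2\leq a_1} \cdots \prod_{0\leq a_{q-1}\leq a_{q-2}} \left(X-\left(1+\xi_D^{a_1}+\cdots+\xi_D^{a_{q-1}}\right)\right).$$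
   Context: $\boldsymbol{e}_{n,k}=\sum_{1\le i_1<\dots<i_k\le n}X_{i_1}\cdots X_{i_k}$ is the elementary symmetric polynomial of degree $k$ in $n$ variables. For $F:\mathbb{F}_q^n\to\mathbb{F}_q$, its exponential sum is $S_{\mathbb{F}_q}(F)=\sum_{\mathbf{x}\in\mathbb{F}_q^n}\exp\!\big(\tfrac{2\pi i}{p}\mathrm{Tr}(F(\mathbf{x}))\big)$, where $\mathrm{Tr}=\mathrm{Tr}_{\mathbb{F}_q/\mathbb{F}_p}$, $\mathrm{Tr}(\alpha)=\sum_{j=0}^{r-1}\alpha^{p^j}$, with values in $\mathbb{F}_p=\{0,\dots,p-1\}$. For a positive integer $m$, $\xi_m=\exp(2\pi i/m)$. $\mathrm{Sym}(j_1,\dots,j_{q-1})$ is the set of all distinct rearrangements (permutations of the entries) of the tuple $(j_1,\dots,j_{q-1})$. Define, for elements $a_1,a_2,\dots$ of $\mathbb{F}_q$, an integer $k$ and nonnegative integers $m_i$: $\Lambda_{a_1}(k,m)=a_1^k\binom{m}{k}$ (taken to be $0$ if $k<0$ or $k>m$; binomial coefficients are mapped into $\mathbb{F}_q$, and $a^0=1$), and recursively $\Lambda_{a_1,\dots,a_{l+1}}(k,m_1,\dots,m_{l+1})=\sum_{j=0}^{m_{l+1}}\binom{m_{l+1}}{j}a_{l+1}^j\Lambda_{a_1,\dots,a_l}(k-j,m_1,\dots,m_l)$. For integers $m_j$, set $m_j^+=m_j$ if $m_j>0$ and $m_j^+=m_j+(\lfloor -m_j/D\rfloor+1)D$ if $m_j\le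 0$, and define $F^{(p)}_{k;\mathbb{F}_q}(m_1,\dots,m_{q-1})=\Lambda_{\alpha_1,\dots,\alpha_{q-1}}(k,m_1^+,\dots,m_{q-1}^+)\in\mathbb{F}_q$. -}

module Defs where

open import Level using (0ℓ)
open import Data.Nat as ℕ using (ℕ; zero; suc; _∸_; _≤_; _<_; _≤?_)
open import Data.Nat.Combinatorics using (_C_)
open import Data.Nat.ListAction using () renaming (sum to ℕsum)
open import Data.Integer as ℤ using (ℤ; +_; -[1+_])
open import Data.Fin as Fin using (Fin)
open import Data.List as List using (List; []; _∷_; map; concatMap; upTo; reverse; zipWith; deduplicate; length; allFin)
open import Data.Vec as Vec using (Vec)
open import Data.Sum using (_⊎_)
open import Data.Product using (Σ; _×_; _,_)
open import Relation.Nullary using (¬_; yes; no)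
open import Relation.Binary using (Decidable)
open import Relation.Binary.PropositionalEquality using (_≡_)
open import Algebra.Bundles using (CommutativeRing)
import Data.List.Properties as LP

module RingOps (R : CommutativeRing 0ℓ 0ℓ) where
  open CommutativeRing R

  pow : Carrier → ℕ → Carrier
  pow x zero    = 1#
  pow x (suc n) = x * pow x n

  castℕ : ℕ → Carrier
  castℕ zero    = 0#
  castℕ (suc n) = 1# + castℕ n

  castℤ : ℤ → Carrier
  castℤ (+ n)      = castℕ n
  castℤ -[1+ n ]   = - castℕ (suc n)

  sumL : List Carrier → Carrier
  sumL = List.foldr _+_ 0#

  sumOver : {A : Set} → List A → (A → Carrier) → Carrier
  sumOver xs f = sumL (map f xs)

allTuples : ℕ → ℕ → List (List ℕ)
allTuples zero    b = [] ∷ []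
allTuples (suc l) b = concatMap (λ j → map (j ∷_) (allTuples l b)) (upTo b)

decTuples : ℕ → ℕ → List (List ℕ)
decTuples zero    b = [] ∷ []
decTuples (suc l) b = concatMap (λ j → map (j ∷_) (decTuples l (suc j))) (upTo b)

insertEverywhere : ℕ → List ℕ → List (List ℕ)
insertEverywhere x []       = (x ∷ []) ∷ []
insertEverywhere x (y ∷ ys) = (x ∷ y ∷ ys) ∷ map (y ∷_) (insertEverywhere x ys)

perms : List ℕ → List (List ℕ)
perms []       = [] ∷ []
perms (x ∷ xs) = concatMap (insertEverywhere x) (perms xs)

Sym : List ℕ → List (List ℕ)
Sym js = deduplicate (LP.≡-dec ℕ._≟_) (perms js)

record FiniteField (p r : ℕ) : Set₁ where
  field
    cring : CommutativeRing 0ℓ 0ℓ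
  open CommutativeRing cring public
  open RingOps cring public
  field
    _≟F_        : Decidable _≈_
    0≉1         : ¬ (0# ≈ 1#)
    inverse     : ∀ x → ¬ (x ≈ 0#) → Σ Carrier (λ y → x * y ≈ 1#)
    charp       : castℕ p ≈ 0#
    α           : Fin (p ℕ.^ r ∸ 1) → Carrier
    α-nonzero   : ∀ i → ¬ (α i ≈ 0#)
    α-injective : ∀ i j → α i ≈ α j → i ≡ j
    α-onto      : ∀ x → ¬ (x ≈ 0#) → Σ (Fin (p ℕ.^ r ∸ 1)) (λ i → x ≈ α i)

module FFOps {p r : ℕ} (F : FiniteField p r) where
  open FiniteField F

  αs : List Carrier
  αs = map α (allFin _)

  elems : List Carrier
  elems = 0# ∷ αs

  points : (n : ℕ) → List (Vec Carrier n)
  points zero    = Vec.[] ∷ []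
  points (suc n) = concatMap (λ x → map (x Vec.∷_) (points n)) elems

  -- elementary symmetric polynomial e_{n,k}(x) = Σ_{i₁<⋯<i_k} x_{i₁}⋯x_{i_k}
  -- (subsets enumerated by deciding whether the first variable is used)
  esym : {n : ℕ} → ℕ → Vec Carrier n → Carrier
  esym zero    _           = 1#
  esym (suc k) Vec.[]      = 0#
  esym (suc k) (x Vec.∷ xs) = x * esym k xs + esym (suc k) xs

  Tr : Carrier → Carrier
  Tr a = sumOver (upTo r) (λ j → pow a (p ℕ.^ j))

  -- representative in {0,…,p-1} of an element of the prime field:
  -- the least m < p with m·1 = a  (0 if none exists)
  toFp : Carrier → ℕ
  toFp a = go (upTo p)
    where
      go : List ℕ → ℕ
      go []       = 0
      go (m ∷ ms) with castℕ m ≟F a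
      ... | yes _ = m
      ... | no  _ = go ms

  -- Λ, with the pairs (aᵢ , mᵢ) listed in REVERSE order (last pair first),
  -- following the recursion that peels off the last pair.
  -- one step of the recursion:
  -- Σ_{j=0}^{m} C(m,j) a^j L(k - j), where L(k - j) = 0 when k - j < 0
  ΛStep : (ℕ → Carrier) → Carrier → ℕ → ℕ → Carrier
  ΛStep L a m k = sumOver (upTo (suc m)) step
    where
      step : ℕ → Carrier
      step j with j ≤? k
      ... | yes _ = castℕ (m C j) * pow a j * L (k ∸ j)
      ... | no  _ = 0#

  ΛR : List (Carrier × ℕ) → ℕ → Carrier
  ΛR []                        k = 0#
  ΛR ((a , m) ∷ [])            k = pow a k * castℕ (m C k)
  ΛR ((a , m) ∷ rest@(_ ∷ _))  k = ΛStep (ΛR rest) a m k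

  Λ : List Carrier → List ℕ → ℕ → Carrier
  Λ as ms k = ΛR (reverse (zipWith _,_ as ms)) k

-- m⁺ for m ∈ {0,…,D-1}: m⁺ = m if m > 0, and 0⁺ = 0 + (⌊-0/D⌋+1)D = D
plus : ℕ → ℕ → ℕ
plus D zero    = D
plus D (suc m) = suc m

module FFOps2 {p r : ℕ} (F : FiniteField p r) where
  open FiniteField F
  open FFOps F

  Fp : (D k : ℕ) → List ℕ → Carrier
  Fp D k ms = Λ αs (map (plus D) ms) k

-- Target: a characteristic-zero integral domain K with a primitive D-th
-- root of unity ζ (standing in for ℂ and ξ_D)

record Char0Domain : Set₁ where
  field
    cring : CommutativeRing 0ℓ 0ℓ
  open CommutativeRing cring public
  open RingOps cring public
  field
    0≉1       : ¬ (0# ≈ 1#)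
    noZeroDiv : ∀ x y → x * y ≈ 0# → (x ≈ 0#) ⊎ (y ≈ 0#)
    char0     : ∀ n → ¬ (castℕ (suc n) ≈ 0#)

record PrimRoot (K : Char0Domain) (D : ℕ) : Set where
  open Char0Domain K public
  field
    ζ         : Carrier
    ζ^D       : pow ζ D ≈ 1#
    ζ-prim    : ∀ d → 0 < d → d < D → ¬ (pow ζ d ≈ 1#)

module Thm {p r : ℕ} (F : FiniteField p r) (K : Char0Domain)
           (e : ℕ) (z : PrimRoot K (p ℕ.^ suc e)) (k : ℕ) where
  private
    module FF = FiniteField F
    module O  = FFOps F
    module O2 = FFOps2 F
  open Char0Domain K public
  open PrimRoot z using (ζ)

  -- q = p^r,  D = p^{⌊log_p k⌋ + 1} = p^{e+1}  (e = ⌊log_p k⌋)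
  q : ℕ
  q = p ℕ.^ r

  D : ℕ
  D = p ℕ.^ suc e

  -- ξ_D = ζ,  ξ_p = ξ_D^{D/p} = ζ^{p^e}
  ξp : Carrier
  ξp = pow ζ (p ℕ.^ e)

  ψ : FF.Carrier → Carrier
  ψ a = pow ξp (O.toFp (O.Tr a))

  S : ℕ → Carrier
  S n = sumOver (O.points n) (λ x → ψ (O.esym k x))

  -- D^{q-1} · c_{j₁,…,j_{q-1}}(k)
  --   = Σ_{b ∈ {0..D-1}^{q-1}} ξ_p^{Tr F^{(p)}_k(b₁,…,b_{q-1})}
  --       Σ_{j' ∈ Sym(j)} ξ_D^{j'₁ b_{q-1} + ⋯ + j'_{q-1} b₁}
  Dc : List ℕ → Carrier
  Dc js = sumOver (allTuples (q ∸ 1) D) λ bs →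
            ψ (O2.Fp D k bs) *
            sumOver (Sym js) (λ js′ → pow ζ (ℕsum (zipWith ℕ._*_ js′ (reverse bs))))

  -- 1 + ξ_D^{-j₁} + ⋯ + ξ_D^{-j_{q-1}}   (ξ_D^{-j} = ζ^{D-j}, 0 ≤ j < D)
  baseNeg : List ℕ → Carrier
  baseNeg js = 1# + sumOver js (λ j → pow ζ (D ∸ j))

  -- D^{q-1} times the right-hand side of the theorem
  DRHS : ℕ → Carrier
  DRHS n = sumOver (decTuples (q ∸ 1) D) (λ js → Dc js * pow (baseNeg js) n)

  -- characteristic polynomial P_{q,k}, as its coefficient list
  -- (constant coefficient first)
  addCoeffs : List Carrier → List Carrier → List Carrier
  addCoeffs []       ys       = ys
  addCoeffs xs       []       = xs
  addCoeffs (x ∷ xs) (y ∷ ys) = (x + y) ∷ addCoeffs xs ys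

  mulLin : Carrier → List Carrier → List Carrier
  mulLin β cs = addCoeffs (0# ∷ cs) (map (λ c → - (β * c)) cs)

  rootP : List ℕ → Carrier
  rootP as = 1# + sumOver as (λ a → pow ζ a)

  P : List Carrier
  P = List.foldr (λ as cs → mulLin (rootP as) cs) (1# ∷ []) (decTuples (q ∸ 1) D)

  recAt : (ℕ → Carrier) → ℕ → Set
  recAt s n = sumL (zipWith (λ i c → c * s (n ℕ.+ i)) (upTo (length P)) P) ≈ 0#

  IntCoeff : Carrier → Set
  IntCoeff c = Σ ℤ (λ m → c ≈ castℤ m)

{-# OPTIONS --safe #-}

-- For x in 𝔽_qⁿ let mᵢ be the number of coordinates of x equal to αᵢ. Then e_{n,k}(x) is the
-- coefficient of tᵏ in ∏ (1 + αᵢ t)^mᵢ, which depends only on the mᵢ modulo D because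
-- (1 + α t)^D ≡ 1 mod tᴰ in characteristic p and k < D. Expand this D-periodic function of
-- (m₁, …, m_{q-1}) in characters: appending a coordinate to x multiplies the sum of a character
-- by 1 + ξ^{-j₁} + ⋯ + ξ^{-j_{q-1}}, whence the formula after grouping the j's by their
-- decreasing rearrangement. The recurrence follows as each of these factors is a root of P.
-- The coefficients of P are symmetric integer polynomials in the D distinct roots of the integer
-- polynomial Xᴰ - 1, hence integers; the fundamental theorem on symmetric polynomials is
-- proved by eliminating the roots one at a time, so no Galois theory enters.

module Submission where

open import Defs
open import Algebra.Bundles using (CommutativeRing)
import Algebra.Properties.CommutativeSemigroup as CommSemigroup
import Algebra.Properties.Ring as RingProperties
import Algebra.Solver.Ring as RingSolver
open import Algebra.Solver.Ring.AlmostCommutativeRing using (_-Raw-AlmostCommutative⟶_; fromCommutativeRing)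
open import Data.Empty using (⊥-elim)
open import Data.Fin using (Fin; suc; zero)
open import Data.Integer as ℤ using (-[1+_]; ℤ)
import Data.Integer.Properties as ℤₚ
open import Data.List as List using (List; []; [_]; _++_; _ʳ++_; _∷_; concatMap; downFrom; foldl; foldr; length; map; reverse; upTo; zipWith)
open import Data.List.Membership.Propositional using (_∈_; find; lose)
open import Data.List.Membership.Propositional.Properties
open import Data.List.Membership.Propositional.Properties.WithK using (unique∧set⇒bag)
import Data.List.Properties as LP
open import Data.List.Relation.Binary.BagAndSetEquality using (∼bag⇒↭)
open import Data.List.Relation.Binary.Permutation.Propositional as Perm using (_↭_; ↭-reflexive; ↭-sym; ↭-trans; ↭⇒↭ₛ; ↭⇒↭ₛ′)
import Data.List.Relation.Binary.Permutation.Propositional.Properties as Permₚ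
import Data.List.Relation.Binary.Permutation.Setoid as PermSetoid
import Data.List.Relation.Binary.Permutation.Setoid.Properties as PermSetoidₚ
open import Data.List.Relation.Binary.Pointwise as Pointwise using (Pointwise; Pointwise-≡⇒≡; []; _∷_)
open import Data.List.Relation.Unary.All as All using (All; []; _∷_)
import Data.List.Relation.Unary.All.Properties as Allₚ
open import Data.List.Relation.Unary.AllPairs as AllPairs using (AllPairs; []; _∷_)
import Data.List.Relation.Unary.AllPairs.Properties as AllPairsₚ
open import Data.List.Relation.Unary.Any using (here; there)
import Data.List.Relation.Unary.Sorted.TotalOrder.Properties as Sortedₚ
open import Data.List.Relation.Unary.Unique.Propositional using (Unique)
import Data.List.Relation.Unary.Unique.Propositional.Properties as Uniqueₚ
import Data.List.Sort
import Data.Maybe as Maybe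
open import Data.Nat as ℕ using (NonZero; _%_; _<_; _^_; _∸_; _≤?_; _≤_; suc; s≤s; zero; z≤n; ℕ)
open import Data.Nat.Combinatorics using (_C_; k>n⇒nCk≡0; nC1≡n; nCk+nC[k+1]≡[n+1]C[k+1])
open import Data.Nat.DivMod using (_/_; m%n%n≡m%n; m%n<n; m*n%n≡0; m≡m%n+[m/n]*n; n%n≡0)
open import Data.Nat.Divisibility using (*-cancelʳ-∣; _∣?_; _∣_; divides; m∣m*n; ∣-trans; ∣⇒≤)
open import Data.Nat.ListAction using () renaming (sum to ℕsum)
open import Data.Nat.Primality using (Prime; euclidsLemma; prime⇒nonTrivial; prime⇒nonZero)
import Data.Nat.Properties as ℕₚ
open import Data.Nat.Solver using (module +-*-Solver)
open import Data.Product using (_,_; _×_; proj₁; proj₂; Σ; ∃)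
import Data.Sign as Sign
open import Data.Sum using (inj₁; inj₂)
open import Data.Vec as Vec using (Vec; []; _∷_; toList)
open import Function using (_∘_; id; mk⇔)
open import Level using (0ℓ)
open import Relation.Binary.Bundles using (DecTotalOrder)
import Relation.Binary.Construct.Flip.EqAndOrd as Flip
open import Relation.Binary.Definitions using (tri<; tri>; tri≈)
open import Relation.Binary.PropositionalEquality as ≡ using (_≡_; _≢_)
open import Relation.Nullary using (no; yes; ¬_)
open import Relation.Nullary.Decidable using (dec⇒maybe)
open import Data.List.Relation.Unary.Unique.DecPropositional.Properties (LP.≡-dec ℕ._≟_) using (deduplicate-!)

-- Sums and powers in commutative rings

-- The numbers mᵢ are never counted. `S n` is placed in a family `W n ms` of sums in which ∏ (1 + αᵢ
-- t)^mᵢ stands as an extra factor with arbitrary exponents. A new coordinate 0 leaves `ms` alone, a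
-- new coordinate αᵢ raises mᵢ by one; this recursion in n replaces multinomial coefficients, and
-- since it acts on all `ms` at once, characters diagonalise it.
--
-- D need not be invertible in `K`, so every formula carries the factor D^(q-1). Only the recurrence
-- cancels it, by characteristic 0.
--
-- The roots of P are 1 plus the sums of the (q-1)-element multisets of D-th roots of unity. Hence P
-- is fixed by every permutation of those D roots, and this full symmetry is what elimination
-- consumes. Two things shape the proof of it: permuting the roots scrambles the listing by
-- descending tuples and alters the bracketing of sums, so lists of roots are compared up to
-- permutation and `≈`; and elimination manipulates polynomials formally, so the coefficients of P
-- are built a second time as expressions in D variables.

upTo-suc : ∀ n → upTo (suc n) ≡ upTo n ++ [ n ]
upTo-suc n = ≡.sym (LP.applyUpTo-∷ʳ id n)

module CommRing (R : CommutativeRing 0ℓ 0ℓ) where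
  open CommutativeRing R hiding (zero)
  open RingOps R
  open RingProperties ring using (-0#≈0#; -‿+-comm; -‿distribˡ-*; -‿distribʳ-*; -‿involutive)
  open import Relation.Binary.Reasoning.Setoid setoid
  open CommSemigroup (CommutativeRing.+-commutativeSemigroup R) using () renaming (interchange to +-interchange)
  open CommSemigroup (CommutativeRing.*-commutativeSemigroup R) using () renaming (interchange to *-interchange)

  castℕ-+ : ∀ m n → castℕ (m ℕ.+ n) ≈ castℕ m + castℕ n
  castℕ-+ zero    n = sym (+-identityˡ _)
  castℕ-+ (suc m) n = trans (+-congˡ (castℕ-+ m n)) (sym (+-assoc _ _ _))

  castℕ-* : ∀ m n → castℕ (m ℕ.* n) ≈ castℕ m * castℕ n
  castℕ-* zero    n = sym (zeroˡ _)
  castℕ-* (suc m) n = begin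
    castℕ (n ℕ.+ m ℕ.* n)             ≈⟨ castℕ-+ n (m ℕ.* n) ⟩
    castℕ n + castℕ (m ℕ.* n)         ≈⟨ +-cong (sym (*-identityˡ _)) (castℕ-* m n) ⟩
    1# * castℕ n + castℕ m * castℕ n  ≈⟨ distribʳ _ _ _ ⟨
    (1# + castℕ m) * castℕ n          ∎

  castℤ-neg : ∀ i → castℤ (ℤ.- i) ≈ - castℤ i
  castℤ-neg (ℤ.+ zero)   = sym -0#≈0#
  castℤ-neg (ℤ.+ suc n)  = refl
  castℤ-neg -[1+ n ]   = sym (-‿involutive _)

  castℤ-⊖ : ∀ m n → castℤ (m ℤ.⊖ n) ≈ castℕ m - castℕ n
  castℤ-⊖ m zero = sym (trans (+-congˡ -0#≈0#) (+-identityʳ _))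
  castℤ-⊖ zero (suc n) = sym (+-identityˡ _)
  castℤ-⊖ (suc m) (suc n) = begin
    castℤ (suc m ℤ.⊖ suc n)               ≡⟨ ≡.cong castℤ (ℤₚ.[1+m]⊖[1+n]≡m⊖n m n) ⟩
    castℤ (m ℤ.⊖ n)                       ≈⟨ castℤ-⊖ m n ⟩
    castℕ m - castℕ n                     ≈⟨ +-identityˡ _ ⟨
    0# + (castℕ m - castℕ n)              ≈⟨ +-congʳ (-‿inverseʳ 1#) ⟨
    (1# - 1#) + (castℕ m - castℕ n)       ≈⟨ +-interchange _ _ _ _ ⟩
    (1# + castℕ m) + (- 1# - castℕ n)     ≈⟨ +-congˡ (-‿+-comm _ _) ⟩
    (1# + castℕ m) - (1# + castℕ n)       ∎

  castℤ-+ : ∀ i j → castℤ (i ℤ.+ j) ≈ castℤ i + castℤ j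
  castℤ-+ (ℤ.+ m)    (ℤ.+ n)    = castℕ-+ m n
  castℤ-+ (ℤ.+ m)    -[1+ n ] = castℤ-⊖ m (suc n)
  castℤ-+ -[1+ m ] (ℤ.+ n)    = trans (castℤ-⊖ n (suc m)) (+-comm _ _)
  castℤ-+ -[1+ m ] -[1+ n ] = begin
    - castℕ (suc (suc (m ℕ.+ n)))        ≡⟨ ≡.cong (λ x → - castℕ (suc x)) (ℕₚ.+-suc m n) ⟨
    - castℕ (suc m ℕ.+ suc n)            ≈⟨ -‿cong (castℕ-+ (suc m) (suc n)) ⟩
    - (castℕ (suc m) + castℕ (suc n))    ≈⟨ -‿+-comm _ _ ⟨
    - castℕ (suc m) - castℕ (suc n)      ∎

  castℤ-* : ∀ i j → castℤ (i ℤ.* j) ≈ castℤ i * castℤ j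
  castℤ-* (ℤ.+ m)    (ℤ.+ n)    = trans (reflexive (≡.cong castℤ (ℤₚ.+◃n≡+n (m ℕ.* n)))) (castℕ-* m n)
  castℤ-* (ℤ.+ m)    -[1+ n ] = begin
    castℤ (Sign.- ℤ.◃ m ℕ.* suc n)       ≡⟨ ≡.cong castℤ (ℤₚ.-◃n≡-n (m ℕ.* suc n)) ⟩
    castℤ (ℤ.- (ℤ.+ (m ℕ.* suc n)))        ≈⟨ castℤ-neg (ℤ.+ (m ℕ.* suc n)) ⟩
    - castℕ (m ℕ.* suc n)                ≈⟨ -‿cong (castℕ-* m (suc n)) ⟩
    - (castℕ m * castℕ (suc n))          ≈⟨ -‿distribʳ-* _ _ ⟩
    castℕ m * - castℕ (suc n)            ∎
  castℤ-* -[1+ m ] (ℤ.+ n)    = begin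
    castℤ (Sign.- ℤ.◃ suc m ℕ.* n)       ≡⟨ ≡.cong castℤ (ℤₚ.-◃n≡-n (suc m ℕ.* n)) ⟩
    castℤ (ℤ.- (ℤ.+ (suc m ℕ.* n)))        ≈⟨ castℤ-neg (ℤ.+ (suc m ℕ.* n)) ⟩
    - castℕ (suc m ℕ.* n)                ≈⟨ -‿cong (castℕ-* (suc m) n) ⟩
    - (castℕ (suc m) * castℕ n)          ≈⟨ -‿distribˡ-* _ _ ⟩
    - castℕ (suc m) * castℕ n            ∎
  castℤ-* -[1+ m ] -[1+ n ] = begin
    castℕ (suc m ℕ.* suc n)              ≈⟨ castℕ-* (suc m) (suc n) ⟩
    castℕ (suc m) * castℕ (suc n)        ≈⟨ -‿involutive _ ⟨
    - - (castℕ (suc m) * castℕ (suc n))  ≈⟨ -‿cong (-‿distribˡ-* _ _) ⟩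
    - (- castℕ (suc m) * castℕ (suc n))  ≈⟨ -‿distribʳ-* _ _ ⟩
    - castℕ (suc m) * - castℕ (suc n)    ∎

  private
    castℤ-morphism : ℤ.+-*-rawRing -Raw-AlmostCommutative⟶ fromCommutativeRing R
    castℤ-morphism = record
      { ⟦_⟧    = castℤ
      ; +-homo = castℤ-+
      ; *-homo = castℤ-*
      ; -‿homo = castℤ-neg
      ; 0-homo = refl
      ; 1-homo = +-identityʳ 1#
      }

  -- Coefficients are taken in ℤ, where equality is decidable, as it need not be in the ring.
  -- `con ℤ.0ℤ` denotes `0#` on the nose, but `castℤ` sends 1 to `1# + 0#`; for this reason `1#` is
  -- passed to the solver as a variable below.
  module Solver = RingSolver ℤ.+-*-rawRing (fromCommutativeRing R) castℤ-morphism
    (λ i j → Maybe.map (λ i≡j → reflexive (≡.cong castℤ i≡j)) (dec⇒maybe (i ℤ.≟ j)))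

  pow-cong : ∀ {x y} n → x ≈ y → pow x n ≈ pow y n
  pow-cong zero    x≈y = refl
  pow-cong (suc n) x≈y = *-cong x≈y (pow-cong n x≈y)

  pow-+ : ∀ x m n → pow x (m ℕ.+ n) ≈ pow x m * pow x n
  pow-+ x zero    n = sym (*-identityˡ _)
  pow-+ x (suc m) n = trans (*-congˡ (pow-+ x m n)) (sym (*-assoc _ _ _))

  pow-* : ∀ x m n → pow x (m ℕ.* n) ≈ pow (pow x n) m
  pow-* x zero    n = refl
  pow-* x (suc m) n = trans (pow-+ x n (m ℕ.* n)) (*-congˡ (pow-* x m n))

  pow-1# : ∀ n → pow 1# n ≈ 1#
  pow-1# zero    = refl
  pow-1# (suc n) = trans (*-identityˡ _) (pow-1# n)

  module _ {A : Set} where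

    sum-++ : ∀ (xs ys : List A) f → sumOver (xs ++ ys) f ≈ sumOver xs f + sumOver ys f
    sum-++ []       ys f = sym (+-identityˡ _)
    sum-++ (x ∷ xs) ys f = trans (+-congˡ (sum-++ xs ys f)) (sym (+-assoc _ _ _))

    sum-cong-∈ : ∀ (xs : List A) {f g} → (∀ x → x ∈ xs → f x ≈ g x) → sumOver xs f ≈ sumOver xs g
    sum-cong-∈ []       f≈g = refl
    sum-cong-∈ (x ∷ xs) f≈g =
      +-cong (f≈g x (here ≡.refl)) (sum-cong-∈ xs (λ y y∈ → f≈g y (there y∈)))

    sum-cong : ∀ (xs : List A) {f g} → (∀ x → f x ≈ g x) → sumOver xs f ≈ sumOver xs g
    sum-cong xs f≈g = sum-cong-∈ xs (λ x _ → f≈g x)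

    sum-0 : ∀ (xs : List A) {f} → (∀ x → x ∈ xs → f x ≈ 0#) → sumOver xs f ≈ 0#
    sum-0 []       f≈0 = refl
    sum-0 (x ∷ xs) f≈0 =
      trans (+-cong (f≈0 x (here ≡.refl)) (sum-0 xs (λ y y∈ → f≈0 y (there y∈)))) (+-identityˡ _)

    sum-+ : ∀ (xs : List A) f g → sumOver xs (λ x → f x + g x) ≈ sumOver xs f + sumOver xs g
    sum-+ []       f g = sym (+-identityˡ _)
    sum-+ (x ∷ xs) f g = trans (+-congˡ (sum-+ xs f g)) (+-interchange _ _ _ _)

    sum-*ˡ : ∀ c (xs : List A) f → sumOver xs (λ x → c * f x) ≈ c * sumOver xs f
    sum-*ˡ c []       f = sym (zeroʳ c)
    sum-*ˡ c (x ∷ xs) f = trans (+-congˡ (sum-*ˡ c xs f)) (sym (distribˡ _ _ _))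

    sum-*ʳ : ∀ c (xs : List A) f → sumOver xs (λ x → f x * c) ≈ sumOver xs f * c
    sum-*ʳ c xs f = begin
      sumOver xs (λ x → f x * c)  ≈⟨ sum-cong xs (λ x → *-comm _ _) ⟩
      sumOver xs (λ x → c * f x)  ≈⟨ sum-*ˡ c xs f ⟩
      c * sumOver xs f            ≈⟨ *-comm _ _ ⟩
      sumOver xs f * c            ∎

    sum-↭ : ∀ {xs ys : List A} f → xs ↭ ys → sumOver xs f ≈ sumOver ys f
    sum-↭ f Perm.refl          = refl
    sum-↭ f (Perm.prep x p)    = +-congˡ (sum-↭ f p)
    sum-↭ f (Perm.swap x y p)  = begin
      f x + (f y + _)    ≈⟨ +-assoc _ _ _ ⟨
      (f x + f y) + _    ≈⟨ +-cong (+-comm _ _) (sum-↭ f p) ⟩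
      (f y + f x) + _    ≈⟨ +-assoc _ _ _ ⟩
      f y + (f x + _)    ∎
    sum-↭ f (Perm.trans p q)   = trans (sum-↭ f p) (sum-↭ f q)

  sum-map : ∀ {A B : Set} (g : A → B) xs f → sumOver (map g xs) f ≡ sumOver xs (f ∘ g)
  sum-map g xs f = ≡.cong sumL (≡.sym (LP.map-∘ xs))

  sum-concatMap : ∀ {A B : Set} (g : A → List B) xs f →
                  sumOver (concatMap g xs) f ≈ sumOver xs (λ x → sumOver (g x) f)
  sum-concatMap g []       f = refl
  sum-concatMap g (x ∷ xs) f =
    trans (sum-++ (g x) (concatMap g xs) f) (+-congˡ (sum-concatMap g xs f))

  sum-swap : ∀ {A B : Set} (xs : List A) (ys : List B) (f : A → B → Carrier) →
             sumOver xs (λ x → sumOver ys (f x)) ≈ sumOver ys (λ y → sumOver xs (λ x → f x y))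
  sum-swap []       ys f = sym (sum-0 ys (λ _ _ → refl))
  sum-swap (x ∷ xs) ys f =
    trans (+-congˡ (sum-swap xs ys f)) (sym (sum-+ ys (f x) (λ y → sumOver xs (λ x → f x y))))

  sum-upTo-suc : ∀ n f → sumOver (upTo (suc n)) f ≈ sumOver (upTo n) f + f n
  sum-upTo-suc n f = begin
    sumOver (upTo (suc n)) f       ≡⟨ ≡.cong (λ l → sumOver l f) (upTo-suc n) ⟩
    sumOver (upTo n ++ [ n ]) f    ≈⟨ sum-++ (upTo n) [ n ] f ⟩
    sumOver (upTo n) f + (f n + 0#) ≈⟨ +-congˡ (+-identityʳ _) ⟩
    sumOver (upTo n) f + f n       ∎

  sum-upTo-head : ∀ n f → sumOver (upTo (suc n)) f ≈ f 0 + sumOver (upTo n) (f ∘ suc)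
  sum-upTo-head n f = +-congˡ (reflexive (≡.cong sumL
    (≡.trans (LP.map-applyUpTo suc f n) (≡.sym (LP.map-applyUpTo id (f ∘ suc) n)))))

  sum-upTo-cong : ∀ n {f g} → (∀ j → j < n → f j ≈ g j) → sumOver (upTo n) f ≈ sumOver (upTo n) g
  sum-upTo-cong zero    f≈g = refl
  sum-upTo-cong (suc n) {f} {g} f≈g = begin
    sumOver (upTo (suc n)) f   ≈⟨ sum-upTo-suc n f ⟩
    sumOver (upTo n) f + f n   ≈⟨ +-cong (sum-upTo-cong n (λ j j<n → f≈g j (ℕₚ.m<n⇒m<1+n j<n))) (f≈g n ℕₚ.≤-refl) ⟩
    sumOver (upTo n) g + g n   ≈⟨ sum-upTo-suc n g ⟨
    sumOver (upTo (suc n)) g   ∎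

  sum-upTo-0 : ∀ n {f} → (∀ j → j < n → f j ≈ 0#) → sumOver (upTo n) f ≈ 0#
  sum-upTo-0 n f≈0 = trans (sum-upTo-cong n f≈0) (sum-0 (upTo n) (λ _ _ → refl))

  sum-upTo-extend : ∀ m n {f} → (∀ j → m ≤ j → f j ≈ 0#) → sumOver (upTo (n ℕ.+ m)) f ≈ sumOver (upTo m) f
  sum-upTo-extend m zero    f≈0 = refl
  sum-upTo-extend m (suc n) {f} f≈0 = begin
    sumOver (upTo (suc n ℕ.+ m)) f          ≈⟨ sum-upTo-suc (n ℕ.+ m) f ⟩
    sumOver (upTo (n ℕ.+ m)) f + f (n ℕ.+ m) ≈⟨ +-cong (sum-upTo-extend m n f≈0) (f≈0 _ (ℕₚ.m≤n+m m n)) ⟩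
    sumOver (upTo m) f + 0#                 ≈⟨ +-identityʳ _ ⟩
    sumOver (upTo m) f                      ∎

  sum-upTo-≤ : ∀ {m n f} → m ≤ n → (∀ j → m ≤ j → f j ≈ 0#) → sumOver (upTo n) f ≈ sumOver (upTo m) f
  sum-upTo-≤ {m} {n} {f} m≤n f≈0 =
    trans (reflexive (≡.cong (λ l → sumOver (upTo l) f) (≡.sym (ℕₚ.m∸n+n≡m m≤n))))
          (sum-upTo-extend m (n ∸ m) f≈0)

  sum-upTo-δ : ∀ n m {f} → m < n → (∀ j → j < n → j ≢ m → f j ≈ 0#) → sumOver (upTo n) f ≈ f m
  sum-upTo-δ (suc n) m {f} m<1+n f≈0 with m ℕ.≟ n
  ... | yes ≡.refl = begin
    sumOver (upTo (suc n)) f   ≈⟨ sum-upTo-suc n f ⟩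
    sumOver (upTo n) f + f n   ≈⟨ +-congʳ (sum-upTo-0 n (λ j j<n → f≈0 j (ℕₚ.m<n⇒m<1+n j<n) (ℕₚ.<⇒≢ j<n))) ⟩
    0# + f n                   ≈⟨ +-identityˡ _ ⟩
    f n                        ∎
  ... | no m≢n = begin
    sumOver (upTo (suc n)) f   ≈⟨ sum-upTo-suc n f ⟩
    sumOver (upTo n) f + f n   ≈⟨ +-cong (sum-upTo-δ n m (ℕₚ.≤∧≢⇒< (ℕₚ.≤-pred m<1+n) m≢n)
                                          (λ j j<n → f≈0 j (ℕₚ.m<n⇒m<1+n j<n)))
                                        (f≈0 n ℕₚ.≤-refl (m≢n ∘ ≡.sym)) ⟩
    f m + 0#                   ≈⟨ +-identityʳ _ ⟩
    f m                        ∎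

-- Binomial coefficients and power series in characteristic p

-- The absorption identity, from Pascal's rule by induction on n. It is the source of divisibility
-- for binomial coefficients of p^s.
[1+k]*[1+n]C[1+k]≡[1+n]*nCk : ∀ n k → suc k ℕ.* (suc n C suc k) ≡ suc n ℕ.* (n C k)
[1+k]*[1+n]C[1+k]≡[1+n]*nCk zero zero    = ≡.refl
[1+k]*[1+n]C[1+k]≡[1+n]*nCk zero (suc k) = begin
  suc (suc k) ℕ.* (1 C suc (suc k))  ≡⟨ ≡.cong (suc (suc k) ℕ.*_) (k>n⇒nCk≡0 {1} {suc (suc k)} (s≤s (s≤s z≤n))) ⟩
  suc (suc k) ℕ.* 0                  ≡⟨ ℕₚ.*-zeroʳ (suc (suc k)) ⟩
  0                                  ≡⟨ ≡.cong (1 ℕ.*_) (k>n⇒nCk≡0 {0} {suc k} (s≤s z≤n)) ⟨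
  1 ℕ.* (0 C suc k)                  ∎
  where open ≡.≡-Reasoning
[1+k]*[1+n]C[1+k]≡[1+n]*nCk (suc n) zero    = ≡.trans (ℕₚ.*-identityˡ _)
  (≡.trans (nC1≡n (suc (suc n))) (≡.sym (ℕₚ.*-identityʳ _)))
[1+k]*[1+n]C[1+k]≡[1+n]*nCk (suc n) (suc k) = begin
  (2 ℕ.+ k) ℕ.* ((2 ℕ.+ n) C (2 ℕ.+ k))
    ≡⟨ ≡.cong ((2 ℕ.+ k) ℕ.*_) (nCk+nC[k+1]≡[n+1]C[k+1] (suc n) (suc k)) ⟨
  (2 ℕ.+ k) ℕ.* (A ℕ.+ (suc n C (2 ℕ.+ k)))
    ≡⟨ solve 3 (λ k A B → (con 2 :+ k) :* (A :+ B) := A :+ ((con 1 :+ k) :* A :+ (con 2 :+ k) :* B)) ≡.refl k A (suc n C (2 ℕ.+ k)) ⟩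
  A ℕ.+ (suc k ℕ.* A ℕ.+ (2 ℕ.+ k) ℕ.* (suc n C (2 ℕ.+ k)))
    ≡⟨ ≡.cong (A ℕ.+_) (≡.cong₂ ℕ._+_ ([1+k]*[1+n]C[1+k]≡[1+n]*nCk n k) ([1+k]*[1+n]C[1+k]≡[1+n]*nCk n (suc k))) ⟩
  A ℕ.+ (suc n ℕ.* (n C k) ℕ.+ suc n ℕ.* (n C suc k))
    ≡⟨ ≡.cong (A ℕ.+_) (ℕₚ.*-distribˡ-+ (suc n) (n C k) (n C suc k)) ⟨
  A ℕ.+ suc n ℕ.* ((n C k) ℕ.+ (n C suc k))
    ≡⟨ ≡.cong (λ x → A ℕ.+ suc n ℕ.* x) (nCk+nC[k+1]≡[n+1]C[k+1] n k) ⟩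
  A ℕ.+ suc n ℕ.* A ∎
  where
  open ≡.≡-Reasoning
  open +-*-Solver
  A = suc n C suc k

-- By Euclid's lemma a factor p of the product lies in m; it is cancelled and s drops by one.
p^s∣mn⇒p^s∣m : ∀ {p} → Prime p → ∀ s m n → ¬ (p ∣ n) → p ^ s ∣ m ℕ.* n → p ^ s ∣ m
p^s∣mn⇒p^s∣m pp zero    m n p∤n _ = divides m (≡.sym (ℕₚ.*-identityʳ m))
p^s∣mn⇒p^s∣m {p} pp (suc s) m n p∤n d with euclidsLemma m n pp (∣-trans (m∣m*n (p ^ s)) d)
... | inj₂ p∣n = ⊥-elim (p∤n p∣n)
... | inj₁ (divides m′ ≡.refl)
  with p^s∣mn⇒p^s∣m pp s m′ n p∤n
         (*-cancelʳ-∣ p {{prime⇒nonZero pp}} (≡.subst₂ _∣_ (ℕₚ.*-comm p (p ^ s)) eq d))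
  where
  open +-*-Solver
  eq : m′ ℕ.* p ℕ.* n ≡ m′ ℕ.* n ℕ.* p
  eq = solve 3 (λ m p n → m :* p :* n := m :* n :* p) ≡.refl m′ p n
... | divides c ≡.refl = divides c (solve 3 (λ c x p → c :* x :* p := c :* (p :* x)) ≡.refl c (p ^ s) p)
  where open +-*-Solver

-- By absorption p^s divides j times the binomial coefficient. If p did not divide the latter, p^s
-- would divide j, which is positive and smaller.
p∣p^sCj : ∀ {p} → Prime p → ∀ s j → 0 < j → j < p ^ s → p ∣ (p ^ s) C j
p∣p^sCj {p} pp s (suc j) _ j<p^s with p ∣? ((p ^ s) C suc j)
... | yes d = d
... | no ∤ = ⊥-elim (ℕₚ.<⇒≱ j<p^s (∣⇒≤ (p^s∣mn⇒p^s∣m pp s (suc j) _ ∤ (absorb (p ^ s) j<p^s))))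
  where
  absorb : ∀ n → suc j < n → n ∣ suc j ℕ.* (n C suc j)
  absorb (suc n) _ = ≡.subst (suc n ∣_) (≡.sym ([1+k]*[1+n]C[1+k]≡[1+n]*nCk n j)) (m∣m*n _)

-- The tuples `ms` + eᵢ, one for each position i: the exponents reachable by appending one nonzero
-- coordinate.
increments : List ℕ → List (List ℕ)
increments []       = []
increments (m ∷ ms) = (suc m ∷ ms) ∷ map (m ∷_) (increments ms)

-- A function ℕ → Carrier is read as the coefficient sequence of a power series.
module Series (R : CommutativeRing 0ℓ 0ℓ) where
  open CommutativeRing R hiding (zero)
  open RingOps R
  open CommRing R
  open import Relation.Binary.Reasoning.Setoid setoid

  infix 4 _≋_
  _≋_ : (ℕ → Carrier) → (ℕ → Carrier) → Set
  L ≋ M = ∀ k → L k ≈ M k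

  one# : ℕ → Carrier
  one# zero    = 1#
  one# (suc k) = 0#

  -- multiplication by 1 + a t
  linMul : Carrier → (ℕ → Carrier) → ℕ → Carrier
  linMul a L zero    = L zero
  linMul a L (suc k) = a * L k + L (suc k)

  -- multiplication by the binomial expansion of (1 + a t)^m
  binMul : Carrier → ℕ → (ℕ → Carrier) → ℕ → Carrier
  binMul a m L k = sumOver (upTo (suc k)) (λ j → castℕ (m C j) * pow a j * L (k ∸ j))

  linMul-cong : ∀ {a b L M} → a ≈ b → L ≋ M → linMul a L ≋ linMul b M
  linMul-cong a≈b L≋M zero    = L≋M zero
  linMul-cong a≈b L≋M (suc k) = +-cong (*-cong a≈b (L≋M k)) (L≋M (suc k))

  linMul-0# : ∀ L → linMul 0# L ≋ L
  linMul-0# L zero    = refl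
  linMul-0# L (suc k) = trans (+-congʳ (zeroˡ _)) (+-identityˡ _)

  linMul-comm : ∀ a b L → linMul a (linMul b L) ≋ linMul b (linMul a L)
  linMul-comm a b L zero          = refl
  linMul-comm a b L (suc zero)    = solve 4 (λ a b x y → a :* x :+ (b :* x :+ y) := b :* x :+ (a :* x :+ y)) refl a b (L 0) (L 1)
    where open Solver
  linMul-comm a b L (suc (suc k)) =
    solve 5 (λ a b x y z → a :* (b :* x :+ y) :+ (b :* y :+ z) := b :* (a :* x :+ y) :+ (a :* y :+ z)) refl
      a b (L k) (L (suc k)) (L (suc (suc k)))
    where open Solver

  binMul-cong : ∀ {a m L M} → L ≋ M → binMul a m L ≋ binMul a m M
  binMul-cong L≋M k = sum-cong (upTo (suc k)) (λ j → *-congˡ (L≋M (k ∸ j)))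

  binMul-zero : ∀ a L → binMul a 0 L ≋ L
  binMul-zero a L k = begin
    binMul a 0 L k                            ≈⟨ sum-upTo-head k _ ⟩
    (1# + 0#) * 1# * L k + sumOver (upTo k) _ ≈⟨ +-cong (*-congʳ (trans (*-identityʳ _) (+-identityʳ _))) (sum-0 (upTo k) vanish) ⟩
    1# * L k + 0#                             ≈⟨ +-identityʳ _ ⟩
    1# * L k                                  ≈⟨ *-identityˡ _ ⟩
    L k                                       ∎
    where
    vanish : ∀ j _ → castℕ (0 C suc j) * pow a (suc j) * L (k ∸ suc j) ≈ 0#
    vanish j _ = begin
      castℕ (0 C suc j) * pow a (suc j) * L (k ∸ suc j)  ≡⟨ ≡.cong (λ c → castℕ c * pow a (suc j) * L (k ∸ suc j)) (k>n⇒nCk≡0 {0} {suc j} (s≤s z≤n)) ⟩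
      0# * pow a (suc j) * L (k ∸ suc j)                 ≈⟨ *-congʳ (zeroˡ _) ⟩
      0# * L (k ∸ suc j)                                 ≈⟨ zeroˡ _ ⟩
      0#                                                 ∎

  -- Pascal's rule, read as (1 + a t)^(m+1) = (1 + a t) (1 + a t)^m. The term j = 0 is split off
  -- because the rule applies only from j = 1 on.
  binMul-suc : ∀ a m L → binMul a (suc m) L ≋ linMul a (binMul a m L)
  binMul-suc a m L zero    = refl
  binMul-suc a m L (suc k) = begin
    binMul a (suc m) L (suc k)
      ≈⟨ sum-upTo-head (suc k) _ ⟩
    t₀ + sumOver (upTo (suc k)) (λ j → castℕ (suc m C suc j) * pow a (suc j) * L (k ∸ j))
      ≈⟨ +-congˡ (sum-cong (upTo (suc k)) pascal) ⟩
    t₀ + sumOver (upTo (suc k)) (λ j → a * (castℕ (m C j) * pow a j * L (k ∸ j)) + castℕ (m C suc j) * pow a (suc j) * L (k ∸ j))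
      ≈⟨ +-congˡ (trans (sum-+ (upTo (suc k)) _ _) (+-congʳ (sum-*ˡ a (upTo (suc k)) _))) ⟩
    t₀ + (a * binMul a m L k + rest)
      ≈⟨ solve 3 (λ x y z → x :+ (y :+ z) := y :+ (x :+ z)) refl _ _ _ ⟩
    a * binMul a m L k + (t₀ + rest)
      ≈⟨ +-congˡ (sum-upTo-head (suc k) _) ⟨
    a * binMul a m L k + binMul a m L (suc k) ∎
    where
    open Solver
    t₀ = castℕ (m C 0) * pow a 0 * L (suc k)
    rest = sumOver (upTo (suc k)) (λ j → castℕ (m C suc j) * pow a (suc j) * L (k ∸ j))
    pascal : ∀ j → castℕ (suc m C suc j) * pow a (suc j) * L (k ∸ j) ≈
                   a * (castℕ (m C j) * pow a j * L (k ∸ j)) + castℕ (m C suc j) * pow a (suc j) * L (k ∸ j)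
    pascal j = begin
      castℕ (suc m C suc j) * pow a (suc j) * L (k ∸ j)
        ≡⟨ ≡.cong (λ c → castℕ c * pow a (suc j) * L (k ∸ j)) (nCk+nC[k+1]≡[n+1]C[k+1] m j) ⟨
      castℕ ((m C j) ℕ.+ (m C suc j)) * pow a (suc j) * L (k ∸ j)
        ≈⟨ *-congʳ (*-congʳ (castℕ-+ (m C j) (m C suc j))) ⟩
      (castℕ (m C j) + castℕ (m C suc j)) * (a * pow a j) * L (k ∸ j)
        ≈⟨ solve 5 (λ x y a p l → (x :+ y) :* (a :* p) :* l := a :* (x :* p :* l) :+ y :* (a :* p) :* l) refl
             (castℕ (m C j)) (castℕ (m C suc j)) a (pow a j) (L (k ∸ j)) ⟩
      _ ∎

  binMul-linMul : ∀ a m b L → binMul a m (linMul b L) ≋ linMul b (binMul a m L)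
  binMul-linMul a zero    b L k = trans (binMul-zero a (linMul b L) k) (sym (linMul-cong refl (binMul-zero a L) k))
  binMul-linMul a (suc m) b L k = begin
    binMul a (suc m) (linMul b L) k      ≈⟨ binMul-suc a m _ k ⟩
    linMul a (binMul a m (linMul b L)) k ≈⟨ linMul-cong refl (binMul-linMul a m b L) k ⟩
    linMul a (linMul b (binMul a m L)) k ≈⟨ linMul-comm a b _ k ⟩
    linMul b (linMul a (binMul a m L)) k ≈⟨ linMul-cong refl (binMul-suc a m L) k ⟨
    linMul b (binMul a (suc m) L) k      ∎

  -- multiplication by ∏ (1 + aᵢ t)^mᵢ
  gen : List Carrier → List ℕ → (ℕ → Carrier) → ℕ → Carrier
  gen (a ∷ as) (m ∷ ms) L = gen as ms (binMul a m L)
  gen (a ∷ as) []       L = L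
  gen []       ms       L = L

  gen-cong : ∀ as ms {L M} → L ≋ M → gen as ms L ≋ gen as ms M
  gen-cong []       ms       L≋M = L≋M
  gen-cong (a ∷ as) []       L≋M = L≋M
  gen-cong (a ∷ as) (m ∷ ms) L≋M = gen-cong as ms (binMul-cong {a} {m} L≋M)

  gen-linMul : ∀ as ms b L → gen as ms (linMul b L) ≋ linMul b (gen as ms L)
  gen-linMul []       ms       b L k = refl
  gen-linMul (a ∷ as) []       b L k = refl
  gen-linMul (a ∷ as) (m ∷ ms) b L k =
    trans (gen-cong as ms (binMul-linMul a m b L) k) (gen-linMul as ms b (binMul a m L) k)

  gen-zeros : ∀ as n L → gen as (List.replicate n 0) L ≋ L
  gen-zeros []       n       L k = refl
  gen-zeros (a ∷ as) zero    L k = refl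
  gen-zeros (a ∷ as) (suc n) L k = trans (gen-cong as _ (binMul-zero a L) k) (gen-zeros as n L k)

  mulAll : ∀ {n} → Vec Carrier n → (ℕ → Carrier) → ℕ → Carrier
  mulAll []       L = L
  mulAll (x ∷ xs) L = linMul x (mulAll xs L)

  mulAll-cong : ∀ {n} (xs : Vec Carrier n) {L M} → L ≋ M → mulAll xs L ≋ mulAll xs M
  mulAll-cong []       L≋M = L≋M
  mulAll-cong (x ∷ xs) L≋M = linMul-cong refl (mulAll-cong xs L≋M)

  mulAll-linMul : ∀ {n} (xs : Vec Carrier n) b L → mulAll xs (linMul b L) ≋ linMul b (mulAll xs L)
  mulAll-linMul []       b L k = refl
  mulAll-linMul (x ∷ xs) b L k =
    trans (linMul-cong refl (mulAll-linMul xs b L) k) (linMul-comm x b _ k)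

  module _ (p : ℕ) (prime-p : Prime p) (charp : castℕ p ≈ 0#) where

    castℕ-∣ : ∀ {n} → p ∣ n → castℕ n ≈ 0#
    castℕ-∣ (divides c ≡.refl) = trans (castℕ-* c p) (trans (*-congˡ charp) (zeroʳ _))

    -- Reading this for all j < p^s says (1 + a t)^(m + p^s) ≡ (1 + a t)^m mod t^(p^s).
    castℕ-C-+ : ∀ s m j → j < p ^ s → castℕ ((p ^ s ℕ.+ m) C j) ≈ castℕ (m C j)
    castℕ-C-+ s zero    zero    _ = refl
    castℕ-C-+ s zero    (suc j) j< = begin
      castℕ ((p ^ s ℕ.+ 0) C suc j) ≡⟨ ≡.cong (λ n → castℕ (n C suc j)) (ℕₚ.+-identityʳ (p ^ s)) ⟩
      castℕ ((p ^ s) C suc j)     ≈⟨ castℕ-∣ (p∣p^sCj prime-p s (suc j) (s≤s z≤n) j<) ⟩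
      0#                          ≡⟨ ≡.cong castℕ (k>n⇒nCk≡0 {0} {suc j} (s≤s z≤n)) ⟨
      castℕ (0 C suc j)           ∎
    castℕ-C-+ s (suc m) zero    _ = refl
    castℕ-C-+ s (suc m) (suc j) j< = begin
      castℕ ((p ^ s ℕ.+ suc m) C suc j)
        ≡⟨ ≡.cong (λ n → castℕ (n C suc j)) (ℕₚ.+-suc (p ^ s) m) ⟩
      castℕ (suc (p ^ s ℕ.+ m) C suc j)
        ≡⟨ ≡.cong castℕ (nCk+nC[k+1]≡[n+1]C[k+1] (p ^ s ℕ.+ m) j) ⟨
      castℕ (((p ^ s ℕ.+ m) C j) ℕ.+ ((p ^ s ℕ.+ m) C suc j))
        ≈⟨ castℕ-+ ((p ^ s ℕ.+ m) C j) ((p ^ s ℕ.+ m) C suc j) ⟩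
      castℕ ((p ^ s ℕ.+ m) C j) + castℕ ((p ^ s ℕ.+ m) C suc j)
        ≈⟨ +-cong (castℕ-C-+ s m j (ℕₚ.<-trans ℕₚ.≤-refl j<)) (castℕ-C-+ s m (suc j) j<) ⟩
      castℕ (m C j) + castℕ (m C suc j)
        ≈⟨ castℕ-+ (m C j) (m C suc j) ⟨
      castℕ ((m C j) ℕ.+ (m C suc j))
        ≡⟨ ≡.cong castℕ (nCk+nC[k+1]≡[n+1]C[k+1] m j) ⟩
      castℕ (suc m C suc j) ∎

    module _ (s : ℕ) where
      private
        D = p ^ s
        instance
          D≢0 : NonZero D
          D≢0 = ℕₚ.m^n≢0 p s {{prime⇒nonZero prime-p}}

      castℕ-C-+* : ∀ t m j → j < D → castℕ ((t ℕ.* D ℕ.+ m) C j) ≈ castℕ (m C j)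
      castℕ-C-+* zero    m j j<D = refl
      castℕ-C-+* (suc t) m j j<D = begin
        castℕ ((D ℕ.+ t ℕ.* D ℕ.+ m) C j)   ≡⟨ ≡.cong (λ n → castℕ (n C j)) (ℕₚ.+-assoc D (t ℕ.* D) m) ⟩
        castℕ ((D ℕ.+ (t ℕ.* D ℕ.+ m)) C j) ≈⟨ castℕ-C-+ s (t ℕ.* D ℕ.+ m) j j<D ⟩
        castℕ ((t ℕ.* D ℕ.+ m) C j)         ≈⟨ castℕ-C-+* t m j j<D ⟩
        castℕ (m C j)                       ∎

      castℕ-C-% : ∀ m j → j < D → castℕ (m C j) ≈ castℕ ((m % D) C j)
      castℕ-C-% m j j<D = trans
        (reflexive (≡.cong (λ n → castℕ (n C j))
          (≡.trans (m≡m%n+[m/n]*n m D) (ℕₚ.+-comm (m % D) _))))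
        (castℕ-C-+* (m / D) (m % D) j j<D)

      -- Coefficients of a product below tᴰ involve only coefficients of the factors below tᴰ, so
      -- agreement modulo tᴰ passes through each multiplication.
      binMul-periodic : ∀ a m n {L M} → m % D ≡ n % D → (∀ k → k < D → L k ≈ M k) →
                        ∀ k → k < D → binMul a m L k ≈ binMul a n M k
      binMul-periodic a m n m≡n L≈M k k<D = sum-upTo-cong (suc k) λ j j≤k →
        let j<D = ℕₚ.≤-<-trans (ℕₚ.≤-pred j≤k) k<D in
        *-cong (*-congʳ (trans (castℕ-C-% m j j<D)
                 (trans (reflexive (≡.cong (λ x → castℕ (x C j)) m≡n)) (sym (castℕ-C-% n j j<D)))))
               (L≈M (k ∸ j) (ℕₚ.≤-<-trans (ℕₚ.m∸n≤m k j) k<D))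

      gen-periodic : ∀ as {ms ns} → Pointwise (λ m n → m % D ≡ n % D) ms ns →
                     ∀ {L M} → (∀ k → k < D → L k ≈ M k) → ∀ k → k < D → gen as ms L k ≈ gen as ns M k
      gen-periodic []       ms≡ns         L≈M = L≈M
      gen-periodic (a ∷ as) []            L≈M = L≈M
      gen-periodic (a ∷ as) (m≡n ∷ ms≡ns) L≈M =
        gen-periodic as ms≡ns (binMul-periodic a _ _ m≡n L≈M)

-- Elementary symmetric polynomials and Λ as coefficients of products of linear factors

module FieldLemmas {p r : ℕ} (F : FiniteField p r) where
  open FiniteField F hiding (zero)
  open FFOps F
  open CommRing cring
  open Series cring
  open import Relation.Binary.Reasoning.Setoid setoid

  esym≈mulAll : ∀ {n} k (xs : Vec Carrier n) → esym k xs ≈ mulAll xs one# k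
  esym≈mulAll zero    []       = refl
  esym≈mulAll zero    (x ∷ xs) = esym≈mulAll zero xs
  esym≈mulAll (suc k) []       = refl
  esym≈mulAll (suc k) (x ∷ xs) = +-cong (*-congˡ (esym≈mulAll k xs)) (esym≈mulAll (suc k) xs)

  Tr-cong : ∀ {a b} → a ≈ b → Tr a ≈ Tr b
  Tr-cong a≈b = sum-cong (upTo r) (λ j → pow-cong (p ^ j) a≈b)

  toFp-cong : ∀ {a b} → a ≈ b → toFp a ≡ toFp b
  toFp-cong {a} {b} a≈b = ≡.trans toFp-a (≡.trans (go-cong (upTo p)) (≡.sym toFp-b))
    where
    -- goᵃ and goᵇ name the local function of toFp at a and at b.
    goᵃ goᵇ : List ℕ → ℕ
    goᵃ = _
    goᵇ = _
    toFp-a : toFp a ≡ goᵃ (upTo p)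
    -- With `upTo p` abstracted to a variable, the equation determines `goᵃ` as a function of that
    -- variable.
    toFp-a with upTo p
    ... | l = ≡.refl {x = goᵃ l}
    toFp-b : toFp b ≡ goᵇ (upTo p)
    toFp-b with upTo p
    ... | l = ≡.refl {x = goᵇ l}
    go-cong : ∀ l → goᵃ l ≡ goᵇ l
    go-cong []      = ≡.refl
    go-cong (m ∷ l) with castℕ m ≟F a | castℕ m ≟F b
    ... | yes _   | yes _   = ≡.refl
    ... | yes m≈a | no m≉b  = ⊥-elim (m≉b (trans m≈a a≈b))
    ... | no m≉a  | yes m≈b = ⊥-elim (m≉a (trans m≈b (sym a≈b)))
    ... | no _    | no _    = go-cong l

  C-beyond : ∀ {x y} m j → m < j → castℕ (m C j) * x * y ≈ 0#
  C-beyond m j m<j = trans (*-congʳ (trans (*-congʳ (reflexive (≡.cong castℕ (k>n⇒nCk≡0 m<j)))) (zeroˡ _))) (zeroˡ _)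

  -- One sum runs to m and is cut off beyond k, the other runs to k while its binomial coefficients
  -- vanish beyond m. Both agree with the sum up to the maximum of m and k.
  ΛStep≈binMul : ∀ L a m k → ΛStep L a m k ≈ binMul a m L k
  ΛStep≈binMul L a m k = begin
    ΛStep L a m k                                 ≡⟨ step-def ⟩
    sumOver (upTo (suc m)) step                   ≈⟨ sum-upTo-≤ (s≤s (ℕₚ.m≤m⊔n m k)) beyond-m ⟨
    sumOver (upTo (suc (m ℕ.⊔ k))) step           ≈⟨ sum-upTo-≤ (s≤s (ℕₚ.m≤n⊔m m k)) beyond-k ⟩
    sumOver (upTo (suc k)) step                   ≈⟨ sum-upTo-cong (suc k) (λ j j≤k → within-k j (ℕₚ.≤-pred j≤k)) ⟩
    binMul a m L k                                ∎
    where
    step : ℕ → Carrier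
    step = _
    step-def : ΛStep L a m k ≡ sumOver (upTo (suc m)) step
    step-def = ≡.refl
    beyond-m : ∀ j → m < j → step j ≈ 0#
    beyond-m j m<j with j ≤? k
    ... | yes _ = C-beyond m j m<j
    ... | no  _ = refl
    beyond-k : ∀ j → k < j → step j ≈ 0#
    beyond-k j k<j with j ≤? k
    ... | yes j≤k = ⊥-elim (ℕₚ.<⇒≱ k<j j≤k)
    ... | no  _   = refl
    within-k : ∀ j → j ≤ k → step j ≈ castℕ (m C j) * pow a j * L (k ∸ j)
    within-k j j≤k with j ≤? k
    ... | yes _   = refl
    ... | no  j≰k = ⊥-elim (j≰k j≤k)

  binMul-one# : ∀ a m k → binMul a m one# k ≈ pow a k * castℕ (m C k)
  binMul-one# a m k = begin
    binMul a m one# k                             ≈⟨ sum-upTo-δ (suc k) k ℕₚ.≤-refl off ⟩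
    castℕ (m C k) * pow a k * one# (k ∸ k)        ≡⟨ ≡.cong (λ i → castℕ (m C k) * pow a k * one# i) (ℕₚ.n∸n≡0 k) ⟩
    castℕ (m C k) * pow a k * 1#                 ≈⟨ *-identityʳ _ ⟩
    castℕ (m C k) * pow a k                      ≈⟨ *-comm _ _ ⟩
    pow a k * castℕ (m C k)                      ∎
    where
    off : ∀ j → j < suc k → j ≢ k → castℕ (m C j) * pow a j * one# (k ∸ j) ≈ 0#
    off j j≤k j≢k with k ∸ j | ℕₚ.m<n⇒0<n∸m (ℕₚ.≤∧≢⇒< (ℕₚ.≤-pred j≤k) j≢k)
    ... | suc _ | _ = zeroʳ _

  pairMul : Carrier × ℕ → (ℕ → Carrier) → ℕ → Carrier
  pairMul (a , m) L = binMul a m L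

  ΛR≈foldr : ∀ l → 0 < length l → ∀ k → ΛR l k ≈ foldr pairMul one# l k
  ΛR≈foldr ((a , m) ∷ [])              _ k = sym (binMul-one# a m k)
  ΛR≈foldr ((a , m) ∷ rest@(_ ∷ _))    _ k = begin
    ΛStep (ΛR rest) a m k                 ≈⟨ ΛStep≈binMul (ΛR rest) a m k ⟩
    binMul a m (ΛR rest) k                ≈⟨ binMul-cong {a} {m} (ΛR≈foldr rest (s≤s z≤n)) k ⟩
    binMul a m (foldr pairMul one# rest) k ∎

  foldl≡gen : ∀ as ms L → foldl (λ M x → pairMul x M) L (zipWith _,_ as ms) ≡ gen as ms L
  foldl≡gen []       ms       L = ≡.refl
  foldl≡gen (a ∷ as) []       L = ≡.refl
  foldl≡gen (a ∷ as) (m ∷ ms) L = foldl≡gen as ms (binMul a m L)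

  -- A right fold over the reversed list is a left fold over the original one, which is how `gen`
  -- accumulates its factors. The list must be nonempty: `ΛR []` is 0, whereas the empty product is
  -- the series 1.
  Λ≈gen : ∀ as ms → 0 < length (zipWith _,_ as ms) → ∀ k → Λ as ms k ≈ gen as ms one# k
  Λ≈gen as ms nonempty k = begin
    ΛR (reverse (zipWith _,_ as ms)) k             ≈⟨ ΛR≈foldr (reverse (zipWith _,_ as ms)) (≡.subst (0 <_) (≡.sym (LP.length-reverse (zipWith _,_ as ms))) nonempty) k ⟩
    foldr pairMul one# (reverse (zipWith _,_ as ms)) k ≡⟨ ≡.cong (λ L → L k) (LP.reverse-foldr pairMul one# (zipWith _,_ as ms)) ⟩
    foldl (λ M x → pairMul x M) one# (zipWith _,_ as ms) k ≡⟨ ≡.cong (λ L → L k) (foldl≡gen as ms one#) ⟩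
    gen as ms one# k                                ∎

module _ (R S : CommutativeRing 0ℓ 0ℓ) where
  open Series R
  open CommutativeRing S using (_≈_; refl; trans; +-cong; reflexive; +-congˡ)
  open RingOps S using (sumOver)
  open CommRing S using (sum-map)

  -- The new factor 1 + a t, with a the i-th entry of `as`, is carried through the other factors
  -- until it meets (1 + a t)^mᵢ and raises that exponent. `H` will be an exponential sum as a
  -- function of the series, which is why two rings occur.
  sum-increments : ∀ (H : (ℕ → CommutativeRing.Carrier R) → CommutativeRing.Carrier S) → (∀ {L M} → L ≋ M → H L ≈ H M) → ∀ as ms L → length as ≡ length ms →
    sumOver as (λ a → H (linMul a (gen as ms L))) ≈ sumOver (increments ms) (λ ms′ → H (gen as ms′ L))
  sum-increments H H-cong []       []       L eq = refl
  sum-increments H H-cong (a ∷ as) (m ∷ ms) L eq = +-cong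
    (H-cong λ k → R.trans (R.sym (gen-linMul as ms a _ k)) (gen-cong as ms (λ i → R.sym (binMul-suc a m L i)) k))
    (trans (sum-increments H H-cong as ms (binMul a m L) (ℕₚ.suc-injective eq))
           (reflexive (≡.sym (sum-map (m ∷_) (increments ms) _))))
    where module R = CommutativeRing R

-- Tuples and their rearrangements

module _ {A B : Set} (f : A → List B) where

  concatMap-∈⁺ : ∀ {x xs y} → x ∈ xs → y ∈ f x → y ∈ concatMap f xs
  concatMap-∈⁺ x∈xs y∈fx = ∈-concatMap⁺ f (lose x∈xs y∈fx)

  concatMap-∈⁻ : ∀ {xs y} → y ∈ concatMap f xs → ∃ λ x → x ∈ xs × y ∈ f x
  concatMap-∈⁻ y∈ = find (∈-concatMap⁻ f y∈)

  concatMap-! : ∀ {xs} → (∀ x → Unique (f x)) → AllPairs (λ x x′ → ∀ y → ¬ (y ∈ f x × y ∈ f x′)) xs →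
                Unique (concatMap f xs)
  concatMap-! unique disjoint =
    Uniqueₚ.concat⁺ (Allₚ.map⁺ (All.universal unique _)) (AllPairsₚ.map⁺ (AllPairs.map (λ d {y} → d y) disjoint))

unique-≈⇒↭ : ∀ {A : Set} {xs ys : List A} → Unique xs → Unique ys →
             (∀ {x} → x ∈ xs → x ∈ ys) → (∀ {x} → x ∈ ys → x ∈ xs) → xs ↭ ys
unique-≈⇒↭ xs! ys! ⊆ ⊇ = ∼bag⇒↭ (unique∧set⇒bag xs! ys! (mk⇔ ⊆ ⊇))

IsTuple : ℕ → ℕ → List ℕ → Set
IsTuple l b t = length t ≡ l × All (_< b) t

IsTuple-resp-↭ : ∀ {l b s t} → s ↭ t → IsTuple l b s → IsTuple l b t
IsTuple-resp-↭ s↭t (|s|≡l , s<b) = ≡.trans (≡.sym (Permₚ.↭-length s↭t)) |s|≡l , Permₚ.All-resp-↭ s↭t s<b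

Descending : List ℕ → Set
Descending = AllPairs (λ x y → y ≤ x)

prefixes-! : ∀ (f : ℕ → List (List ℕ)) → (∀ j → Unique (f j)) → ∀ b →
             Unique (concatMap (λ j → map (j ∷_) (f j)) (upTo b))
prefixes-! f f! b = concatMap-! (λ j → map (j ∷_) (f j)) (λ j → Uniqueₚ.map⁺ LP.∷-injectiveʳ (f! j))
  (AllPairs.map disjoint (Uniqueₚ.upTo⁺ b))
  where
  disjoint : ∀ {i j} → i ≢ j → ∀ t → ¬ (t ∈ map (i ∷_) (f i) × t ∈ map (j ∷_) (f j))
  disjoint i≢j t (t∈ , t∈′) with ∈-map⁻ _ t∈ | ∈-map⁻ _ t∈′
  ... | _ , _ , ≡.refl | _ , _ , eq = i≢j (LP.∷-injectiveˡ eq)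

allTuples-! : ∀ l b → Unique (allTuples l b)
allTuples-! zero    b = [] ∷ []
allTuples-! (suc l) b = prefixes-! (λ _ → allTuples l b) (λ _ → allTuples-! l b) b

decTuples-! : ∀ l b → Unique (decTuples l b)
decTuples-! zero    b = [] ∷ []
decTuples-! (suc l) b = prefixes-! (λ j → decTuples l (suc j)) (λ j → decTuples-! l (suc j)) b

∈-allTuples⁺ : ∀ l b {t} → IsTuple l b t → t ∈ allTuples l b
∈-allTuples⁺ zero    b {[]}    _                  = here ≡.refl
∈-allTuples⁺ (suc l) b {j ∷ t} (eq , j<b ∷ t<b) =
  concatMap-∈⁺ _ (∈-upTo⁺ j<b) (∈-map⁺ (j ∷_) (∈-allTuples⁺ l b (ℕₚ.suc-injective eq , t<b)))

∈-allTuples⁻ : ∀ l b {t} → t ∈ allTuples l b → IsTuple l b t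
∈-allTuples⁻ zero    b (here ≡.refl) = ≡.refl , []
∈-allTuples⁻ (suc l) b t∈ with concatMap-∈⁻ (λ j → map (j ∷_) (allTuples l b)) {xs = upTo b} t∈
... | j , j∈ , t∈′ with ∈-map⁻ _ t∈′
... | t′ , t′∈ , ≡.refl with ∈-allTuples⁻ l b t′∈
... | eq , t′<b = ≡.cong suc eq , ∈-upTo⁻ j∈ ∷ t′<b

∈-decTuples⁺ : ∀ l b {t} → IsTuple l b t → Descending t → t ∈ decTuples l b
∈-decTuples⁺ zero    b {[]}    _                 _          = here ≡.refl
∈-decTuples⁺ (suc l) b {j ∷ t} (eq , j<b ∷ t<b) (t≤j ∷ t↘) =
  concatMap-∈⁺ _ (∈-upTo⁺ j<b)
    (∈-map⁺ (j ∷_) (∈-decTuples⁺ l (suc j) (ℕₚ.suc-injective eq , All.map s≤s t≤j) t↘))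

∈-decTuples⁻ : ∀ l b {t} → t ∈ decTuples l b → IsTuple l b t × Descending t
∈-decTuples⁻ zero    b (here ≡.refl) = (≡.refl , []) , []
∈-decTuples⁻ (suc l) b t∈ with concatMap-∈⁻ (λ j → map (j ∷_) (decTuples l (suc j))) {xs = upTo b} t∈
... | j , j∈ , t∈′ with ∈-map⁻ _ t∈′
... | t′ , t′∈ , ≡.refl with ∈-decTuples⁻ l (suc j) t′∈
... | (eq , t′≤j) , t′↘ =
  (≡.cong suc eq , ∈-upTo⁻ j∈ ∷ All.map (λ x≤j → ℕₚ.≤-<-trans (ℕₚ.≤-pred x≤j) (∈-upTo⁻ j∈)) t′≤j) ,
  All.map ℕₚ.≤-pred t′≤j ∷ t′↘

∈-insertEverywhere⁺ : ∀ x ys zs → ys ++ x ∷ zs ∈ insertEverywhere x (ys ++ zs)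
∈-insertEverywhere⁺ x []       []       = here ≡.refl
∈-insertEverywhere⁺ x []       (z ∷ zs) = here ≡.refl
∈-insertEverywhere⁺ x (y ∷ ys) zs       = there (∈-map⁺ (y ∷_) (∈-insertEverywhere⁺ x ys zs))

∈-insertEverywhere⁻ : ∀ x ys {t} → t ∈ insertEverywhere x ys → t ↭ x ∷ ys
∈-insertEverywhere⁻ x []       (here ≡.refl) = Perm.refl
∈-insertEverywhere⁻ x (y ∷ ys) (here ≡.refl) = Perm.refl
∈-insertEverywhere⁻ x (y ∷ ys) (there t∈) with ∈-map⁻ _ t∈
... | t′ , t′∈ , ≡.refl = Perm.trans (Perm.prep y (∈-insertEverywhere⁻ x ys t′∈)) (Perm.swap y x Perm.refl)

∈-perms⁺ : ∀ js {t} → t ↭ js → t ∈ perms js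
∈-perms⁺ [] t↭[] with Permₚ.↭-empty-inv t↭[]
... | ≡.refl = here ≡.refl
∈-perms⁺ (x ∷ js) t↭ with ∈-∃++ (Permₚ.∈-resp-↭ (↭-sym t↭) (here ≡.refl))
... | ys , zs , ≡.refl =
  concatMap-∈⁺ _ (∈-perms⁺ js (Permₚ.drop-mid ys [] t↭)) (∈-insertEverywhere⁺ x ys zs)

∈-perms⁻ : ∀ js {t} → t ∈ perms js → t ↭ js
∈-perms⁻ []       (here ≡.refl) = Perm.refl
∈-perms⁻ (x ∷ js) t∈ with concatMap-∈⁻ (insertEverywhere x) {xs = perms js} t∈
... | t′ , t′∈ , t∈′ = Perm.trans (∈-insertEverywhere⁻ x t′ t∈′) (Perm.prep x (∈-perms⁻ js t′∈))

∈-Sym⁺ : ∀ js {t} → t ↭ js → t ∈ Sym js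
∈-Sym⁺ js t↭js = ∈-deduplicate⁺ (LP.≡-dec ℕ._≟_) (∈-perms⁺ js t↭js)

∈-Sym⁻ : ∀ js {t} → t ∈ Sym js → t ↭ js
∈-Sym⁻ js t∈ = ∈-perms⁻ js (∈-deduplicate⁻ (LP.≡-dec ℕ._≟_) (perms js) t∈)

private
  ≥-decTotalOrder = Flip.decTotalOrder ℕₚ.≤-decTotalOrder
  ≥-totalOrder    = DecTotalOrder.totalOrder ≥-decTotalOrder
  module Sort = Data.List.Sort ≥-decTotalOrder

Descending-↭⇒≡ : ∀ {s t} → Descending s → Descending t → s ↭ t → s ≡ t
Descending-↭⇒≡ s↘ t↘ s↭t = Pointwise-≡⇒≡ (Sortedₚ.↗↭↗⇒≋ ≥-totalOrder
  (Sortedₚ.AllPairs⇒Sorted ≥-totalOrder s↘) (Sortedₚ.AllPairs⇒Sorted ≥-totalOrder t↘) (↭⇒↭ₛ s↭t))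

sort-decTuple : ∀ l b {t} → IsTuple l b t → ∃ λ js → js ∈ decTuples l b × t ↭ js
sort-decTuple l b {t} t-ok = Sort.sort t ,
  ∈-decTuples⁺ l b (IsTuple-resp-↭ t↭ t-ok) (Sortedₚ.Sorted⇒AllPairs ≥-totalOrder (Sort.sort-↗ t)) , t↭
  where t↭ = ↭-sym (Sort.sort-↭ t)

-- The classes are disjoint because a descending rearrangement is unique, and exhaustive because one
-- exists by sorting. Deduplication in `Sym` ensures that a tuple with repeated entries occurs once.
Sym-decTuples↭allTuples : ∀ l b → concatMap Sym (decTuples l b) ↭ allTuples l b
Sym-decTuples↭allTuples l b = unique-≈⇒↭ Syms! (allTuples-! l b) ⊆ ⊇
  where
  disjoint : ∀ {js js′} → js ∈ decTuples l b → js′ ∈ decTuples l b → js ≢ js′ → ∀ t → ¬ (t ∈ Sym js × t ∈ Sym js′)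
  disjoint {js} {js′} js∈ js′∈ js≢ t (t∈ , t∈′) =
    js≢ (Descending-↭⇒≡ (proj₂ (∈-decTuples⁻ l b js∈)) (proj₂ (∈-decTuples⁻ l b js′∈))
          (↭-trans (↭-sym (∈-Sym⁻ js t∈)) (∈-Sym⁻ js′ t∈′)))
  disjoints : ∀ {xs} → All (_∈ decTuples l b) xs → Unique xs → AllPairs (λ js js′ → ∀ t → ¬ (t ∈ Sym js × t ∈ Sym js′)) xs
  disjoints []           []         = []
  disjoints (js∈ ∷ xs∈) (js∉ ∷ xs!) = All.zipWith (λ (js′∈ , js≢) → disjoint js∈ js′∈ js≢) (xs∈ , js∉) ∷ disjoints xs∈ xs!
  Syms! : Unique (concatMap Sym (decTuples l b))
  Syms! = concatMap-! Sym (λ js → deduplicate-! (perms js)) (disjoints (All.tabulate id) (decTuples-! l b))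
  ⊆ : ∀ {t} → t ∈ concatMap Sym (decTuples l b) → t ∈ allTuples l b
  ⊆ t∈ with concatMap-∈⁻ Sym {xs = decTuples l b} t∈
  ... | js , js∈ , t∈′ = ∈-allTuples⁺ l b (IsTuple-resp-↭ (↭-sym (∈-Sym⁻ js t∈′)) (proj₁ (∈-decTuples⁻ l b js∈)))
  ⊇ : ∀ {t} → t ∈ allTuples l b → t ∈ concatMap Sym (decTuples l b)
  ⊇ t∈ with sort-decTuple l b (∈-allTuples⁻ l b t∈)
  ... | js , js∈ , t↭js = concatMap-∈⁺ Sym js∈ (∈-Sym⁺ js t↭js)

-- The coefficients of the theorem pair j′ with b in reverse order; reindexing the sum over all
-- tuples by reversal undoes this.
reverse-allTuples↭ : ∀ l b → map reverse (allTuples l b) ↭ allTuples l b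
reverse-allTuples↭ l b = unique-≈⇒↭ (Uniqueₚ.map⁺ LP.reverse-injective (allTuples-! l b)) (allTuples-! l b) ⊆ ⊇
  where
  reverse∈ : ∀ {t} → t ∈ allTuples l b → reverse t ∈ allTuples l b
  reverse∈ {t} t∈ = ∈-allTuples⁺ l b (IsTuple-resp-↭ (↭-sym (Permₚ.↭-reverse t)) (∈-allTuples⁻ l b t∈))
  ⊆ : ∀ {t} → t ∈ map reverse (allTuples l b) → t ∈ allTuples l b
  ⊆ t∈ with ∈-map⁻ reverse t∈
  ... | t′ , t′∈ , ≡.refl = reverse∈ t′∈
  ⊇ : ∀ {t} → t ∈ allTuples l b → t ∈ map reverse (allTuples l b)
  ⊇ {t} t∈ = ≡.subst (_∈ map reverse (allTuples l b)) (LP.reverse-involutive t) (∈-map⁺ reverse (reverse∈ t∈))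

-- Separates the tuples whose leading, hence largest, entry is b. This is the recursion of
-- `multisetSums`: use the first element and keep it available, or discard it.
decTuples-suc : ∀ l b → decTuples (suc l) (suc b) ≡ decTuples (suc l) b ++ map (b ∷_) (decTuples l (suc b))
decTuples-suc l b = begin
  concatMap g (upTo (suc b))            ≡⟨ ≡.cong (concatMap g) (upTo-suc b) ⟩
  concatMap g (upTo b ++ b ∷ [])        ≡⟨ LP.concatMap-++ g (upTo b) (b ∷ []) ⟩
  concatMap g (upTo b) ++ (g b ++ [])   ≡⟨ ≡.cong (concatMap g (upTo b) ++_) (LP.++-identityʳ (g b)) ⟩
  concatMap g (upTo b) ++ g b           ∎
  where
  open ≡.≡-Reasoning
  g : ℕ → List (List ℕ)
  g j = map (j ∷_) (decTuples l (suc j))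

-- Symmetric functions of the roots of a monic integer polynomial

AllPairs-++⁻ˡ : ∀ {A : Set} {R : A → A → Set} xs {ys} → AllPairs R (xs ++ ys) → AllPairs R xs
AllPairs-++⁻ˡ []       _          = []
AllPairs-++⁻ˡ (x ∷ xs) (px ∷ pxs) = Allₚ.++⁻ˡ xs px ∷ AllPairs-++⁻ˡ xs pxs

-- polynomials with integer coefficients in n variables
data Expr (n : ℕ) : Set where
  zero one : Expr n
  var      : Fin n → Expr n
  add mul  : Expr n → Expr n → Expr n
  neg      : Expr n → Expr n

weaken : ∀ {n} → Expr n → Expr (suc n)
weaken zero      = zero
weaken one       = one
weaken (var i)   = var (suc i)
weaken (add f g) = add (weaken f) (weaken g)
weaken (mul f g) = mul (weaken f) (weaken g)
weaken (neg f)   = neg (weaken f)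

-- The leading coefficient 1 is left implicit, so a vector of length d is a monic polynomial of
-- degree exactly d.
hornerE : ∀ {n d} → Vec (Expr n) d → Expr n → Expr n
hornerE []       x = one
hornerE (a ∷ as) x = add a (mul x (hornerE as x))

-- Synthetic division by X - x: the coefficients of the quotient are the values at x of the
-- successive tails. The last tail is the constant 1, again implicit.
quotientE : ∀ {n d} → Expr n → Vec (Expr n) (suc d) → Vec (Expr n) d
quotientE x (a ∷ [])         = []
quotientE x (a ∷ as@(_ ∷ _)) = hornerE as x ∷ quotientE x as

zeros : ∀ {n} d → Vec (Expr n) d
zeros d = Vec.replicate d zero

lastFrom : ∀ {A : Set} {n} → A → Vec A n → A
lastFrom b []       = b
lastFrom b (c ∷ cs) = lastFrom c cs

-- multiplication by the variable y in the basis 1, y, …, modulo y^d + ⋯ + m₁ y + m₀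
shiftSub : ∀ {n d} → Expr n → Expr n → Vec (Expr n) d → Vec (Expr n) d → Vec (Expr n) d
shiftSub l b []       []       = []
shiftSub l b (c ∷ cs) (m ∷ ms) = add b (neg (mul l m)) ∷ shiftSub l c cs ms

mulVar : ∀ {n d} → Vec (Expr n) d → Vec (Expr n) d → Vec (Expr n) d
mulVar ms cs = shiftSub (lastFrom zero cs) zero cs ms

-- Horner's scheme in the first factor, reduced after each multiplication by the variable, so that
-- degrees never grow.
mulMod : ∀ {n d e} → Vec (Expr n) d → Vec (Expr n) e → Vec (Expr n) d → Vec (Expr n) d
mulMod ms []       cs = zeros _
mulMod ms (b ∷ bs) cs = Vec.zipWith add (Vec.map (mul b) cs) (mulVar ms (mulMod ms bs cs))

-- The remainder of an expression, as a polynomial in variable 0 over the others, modulo the monic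
-- polynomial `ms`. The modulus has positive degree so that there is a constant coefficient to hold
-- 1.
reduce : ∀ {n d} → Vec (Expr n) (suc d) → Expr (suc n) → Vec (Expr n) (suc d)
reduce ms zero          = zeros _
reduce ms one           = one ∷ zeros _
-- Multiplying 1 by the variable also covers a modulus of degree 1, where the variable itself has to
-- be replaced by a constant.
reduce ms (var zero)    = mulVar ms (one ∷ zeros _)
reduce ms (var (suc i)) = var i ∷ zeros _
reduce ms (add f g)     = Vec.zipWith add (reduce ms f) (reduce ms g)
reduce ms (mul f g)     = mulMod ms (reduce ms f) (reduce ms g)
reduce ms (neg f)       = Vec.map neg (reduce ms f)

evalℤ : Expr 0 → ℤ
evalℤ zero      = ℤ.0ℤ
evalℤ one       = ℤ.1ℤ
evalℤ (add f g) = evalℤ f ℤ.+ evalℤ g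
evalℤ (mul f g) = evalℤ f ℤ.* evalℤ g
evalℤ (neg f)   = ℤ.- evalℤ f

module Elimination (K : Char0Domain) where
  open Char0Domain K hiding (zero)
  open CommRing cring
  open RingProperties ring using (x∙y⁻¹≈ε⇒x≈y; x≈y⇒x∙y⁻¹≈ε; -0#≈0#)
  open Solver using (solve; _:+_; _:*_; _:-_; :-_; con; _:=_)
  open import Relation.Binary.Reasoning.Setoid setoid

  ≉-sym : ∀ {x y} → x ≉ y → y ≉ x
  ≉-sym x≉y y≈x = x≉y (sym y≈x)

  *-cancel-difference : ∀ {x y z} → x ≉ y → (x - y) * z ≈ 0# → z ≈ 0#
  *-cancel-difference {x} {y} {z} x≉y eq with noZeroDiv _ _ eq
  ... | inj₁ x-y≈0 = ⊥-elim (x≉y (x∙y⁻¹≈ε⇒x≈y x y x-y≈0))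
  ... | inj₂ z≈0   = z≈0

  horner : ∀ {n} → Vec Carrier n → Carrier → Carrier
  horner []       t = 0#
  horner (a ∷ as) t = a + t * horner as t

  -- Horner evaluation of a₀ + ⋯ + aₙ₋₁ tⁿ⁻¹ + tⁿ
  hornerMonic : ∀ {n} → Vec Carrier n → Carrier → Carrier
  hornerMonic []       t = 1#
  hornerMonic (a ∷ as) t = a + t * hornerMonic as t

  quotient : ∀ {n} → Carrier → Vec Carrier (suc n) → Vec Carrier n
  quotient x (a ∷ [])         = []
  quotient x (a ∷ as@(_ ∷ _)) = horner as x ∷ quotient x as

  horner-quotient : ∀ {n} x t (as : Vec Carrier (suc n)) →
                    horner as t ≈ (t - x) * horner (quotient x as) t + horner as x
  horner-quotient x t (a ∷ [])         =
    solve 3 (λ a t x → a :+ t :* con ℤ.0ℤ := (t :- x) :* con ℤ.0ℤ :+ (a :+ x :* con ℤ.0ℤ)) refl a t x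
  horner-quotient x t (a ∷ as@(_ ∷ _)) = begin
    a + t * horner as t
      ≈⟨ +-congˡ (*-congˡ (horner-quotient x t as)) ⟩
    a + t * ((t - x) * horner (quotient x as) t + horner as x)
      ≈⟨ solve 5 (λ a t x q c → a :+ t :* ((t :- x) :* q :+ c) := (t :- x) :* (c :+ t :* q) :+ (a :+ x :* c)) refl
           a t x (horner (quotient x as) t) (horner as x) ⟩
    (t - x) * (horner as x + t * horner (quotient x as) t) + (a + x * horner as x) ∎

  -- Division by X - x leaves one coefficient fewer, and the remaining roots pass to the quotient
  -- because their differences from x can be cancelled in a domain.
  roots⇒zero : ∀ {n} (as : Vec Carrier n) l → length l ≡ n → AllPairs _≉_ l →
               All (λ y → horner as y ≈ 0#) l → ∀ t → horner as t ≈ 0#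
  roots⇒zero {zero}  []  l       _  _          _            t = refl
  roots⇒zero {suc n} as  (x ∷ l) eq (x≉l ∷ l≉) (x-root ∷ l-roots) t = begin
    horner as t                                          ≈⟨ horner-quotient x t as ⟩
    (t - x) * horner (quotient x as) t + horner as x     ≈⟨ +-cong (*-congˡ q≈0) x-root ⟩
    (t - x) * 0# + 0#                                    ≈⟨ trans (+-identityʳ _) (zeroʳ _) ⟩
    0#                                                   ∎
    where
    q-root : ∀ {y} → x ≉ y → horner as y ≈ 0# → horner (quotient x as) y ≈ 0#
    q-root {y} x≉y y-root = *-cancel-difference (≉-sym x≉y) (begin
      (y - x) * horner (quotient x as) y                 ≈⟨ +-identityʳ _ ⟨
      (y - x) * horner (quotient x as) y + 0#            ≈⟨ +-congˡ x-root ⟨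
      (y - x) * horner (quotient x as) y + horner as x   ≈⟨ horner-quotient x y as ⟨
      horner as y                                        ≈⟨ y-root ⟩
      0#                                                 ∎)
    q≈0 : horner (quotient x as) t ≈ 0#
    q≈0 = roots⇒zero (quotient x as) l (ℕₚ.suc-injective eq) l≉
      (All.zipWith (λ (x≉y , y-root) → q-root x≉y y-root) (x≉l , l-roots)) t

  eval : ∀ {n} → Vec Carrier n → Expr n → Carrier
  eval u zero      = 0#
  eval u one       = 1#
  eval u (var i)   = Vec.lookup u i
  eval u (add f g) = eval u f + eval u g
  eval u (mul f g) = eval u f * eval u g
  eval u (neg f)   = - eval u f

  eval-weaken : ∀ {n} y (u : Vec Carrier n) f → eval (y ∷ u) (weaken f) ≡ eval u f
  eval-weaken y u zero      = ≡.refl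
  eval-weaken y u one       = ≡.refl
  eval-weaken y u (var i)   = ≡.refl
  eval-weaken y u (add f g) = ≡.cong₂ _+_ (eval-weaken y u f) (eval-weaken y u g)
  eval-weaken y u (mul f g) = ≡.cong₂ _*_ (eval-weaken y u f) (eval-weaken y u g)
  eval-weaken y u (neg f)   = ≡.cong -_ (eval-weaken y u f)

  eval-evalℤ : ∀ f → eval [] f ≈ castℤ (evalℤ f)
  eval-evalℤ zero      = refl
  eval-evalℤ one       = sym (+-identityʳ 1#)
  eval-evalℤ (add f g) = trans (+-cong (eval-evalℤ f) (eval-evalℤ g)) (sym (castℤ-+ (evalℤ f) (evalℤ g)))
  eval-evalℤ (mul f g) = trans (*-cong (eval-evalℤ f) (eval-evalℤ g)) (sym (castℤ-* (evalℤ f) (evalℤ g)))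
  eval-evalℤ (neg f)   = trans (-‿cong (eval-evalℤ f)) (sym (castℤ-neg (evalℤ f)))

  module _ {n : ℕ} (u : Vec Carrier n) where

    evalAll : ∀ {d} → Vec (Expr n) d → Vec Carrier d
    evalAll = Vec.map (eval u)

    eval-hornerE : ∀ {d} (ms : Vec (Expr n) d) x → eval u (hornerE ms x) ≡ hornerMonic (evalAll ms) (eval u x)
    eval-hornerE []       x = ≡.refl
    eval-hornerE (m ∷ ms) x = ≡.cong (λ v → eval u m + eval u x * v) (eval-hornerE ms x)

    hornerMonic-quotientE : ∀ {d} (x : Expr n) t (ms : Vec (Expr n) (suc d)) →
      hornerMonic (evalAll ms) t ≈ (t - eval u x) * hornerMonic (evalAll (quotientE x ms)) t + hornerMonic (evalAll ms) (eval u x)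
    hornerMonic-quotientE x t (m ∷ [])         =
      solve 4 (λ m t x i → m :+ t :* i := (t :- x) :* i :+ (m :+ x :* i)) refl (eval u m) t (eval u x) 1#
    hornerMonic-quotientE x t (m ∷ ms@(_ ∷ _)) = begin
      a + t * hornerMonic (evalAll ms) t
        ≈⟨ +-congˡ (*-congˡ (hornerMonic-quotientE x t ms)) ⟩
      a + t * ((t - x′) * q + c)
        ≈⟨ solve 5 (λ a t x q c → a :+ t :* ((t :- x) :* q :+ c) := (t :- x) :* (c :+ t :* q) :+ (a :+ x :* c)) refl a t x′ q c ⟩
      (t - x′) * (c + t * q) + (a + x′ * c)
        ≈⟨ +-congʳ (*-congˡ (+-congʳ (reflexive (eval-hornerE ms x)))) ⟨
      (t - x′) * (eval u (hornerE ms x) + t * q) + (a + x′ * c) ∎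
      where
      a = eval u m
      x′ = eval u x
      q = hornerMonic (evalAll (quotientE x ms)) t
      c = hornerMonic (evalAll ms) x′

    module _ (y : Carrier) where

      value : ∀ {d} → Vec (Expr n) d → Carrier
      value cs = horner (evalAll cs) y

      value-zeros : ∀ d → value (zeros d) ≈ 0#
      value-zeros zero    = refl
      value-zeros (suc d) = trans (+-identityˡ _) (trans (*-congˡ (value-zeros d)) (zeroʳ _))

      value-constant : ∀ d f → value (f ∷ zeros d) ≈ eval u f
      value-constant d f = trans (+-congˡ (trans (*-congˡ (value-zeros d)) (zeroʳ _))) (+-identityʳ _)

      value-add : ∀ {d} (bs cs : Vec (Expr n) d) → value (Vec.zipWith add bs cs) ≈ value bs + value cs
      value-add []       []       = sym (+-identityˡ _)
      value-add (b ∷ bs) (c ∷ cs) = begin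
        (eval u b + eval u c) + y * value (Vec.zipWith add bs cs)
          ≈⟨ +-congˡ (*-congˡ (value-add bs cs)) ⟩
        (eval u b + eval u c) + y * (value bs + value cs)
          ≈⟨ solve 5 (λ b c y v w → (b :+ c) :+ y :* (v :+ w) := (b :+ y :* v) :+ (c :+ y :* w)) refl
               (eval u b) (eval u c) y (value bs) (value cs) ⟩
        (eval u b + y * value bs) + (eval u c + y * value cs) ∎

      value-scale : ∀ {d} f (cs : Vec (Expr n) d) → value (Vec.map (mul f) cs) ≈ eval u f * value cs
      value-scale f []       = sym (zeroʳ _)
      value-scale f (c ∷ cs) = begin
        eval u f * eval u c + y * value (Vec.map (mul f) cs) ≈⟨ +-congˡ (*-congˡ (value-scale f cs)) ⟩
        eval u f * eval u c + y * (eval u f * value cs)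
          ≈⟨ solve 4 (λ f c y v → f :* c :+ y :* (f :* v) := f :* (c :+ y :* v)) refl (eval u f) (eval u c) y (value cs) ⟩
        eval u f * (eval u c + y * value cs) ∎

      value-neg : ∀ {d} (cs : Vec (Expr n) d) → value (Vec.map neg cs) ≈ - value cs
      value-neg []       = sym -0#≈0#
      value-neg (c ∷ cs) = trans (+-congˡ (*-congˡ (value-neg cs)))
        (solve 3 (λ c y v → :- c :+ y :* (:- v) := :- (c :+ y :* v)) refl (eval u c) y (value cs))

      -- Here b is the coefficient carried over from the preceding position and l an arbitrary
      -- multiple of the modulus to subtract. The last summand accounts for the two leading terms
      -- and vanishes when l is the last coefficient, the choice made by `mulVar`.
      value-shiftSub : ∀ {d} l b (cs ms : Vec (Expr n) d) →
        value (shiftSub l b cs ms) ≈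
        (eval u b + y * value cs) - eval u l * hornerMonic (evalAll ms) y
          + (eval u l - eval u (lastFrom b cs)) * pow y d
      value-shiftSub l b [] [] =
        sym (trans (+-cong (+-congˡ (-‿cong (*-identityʳ _))) (*-identityʳ _))
          (solve 3 (λ l b y → (b :+ y :* con ℤ.0ℤ) :- l :+ (l :- b) := con ℤ.0ℤ) refl (eval u l) (eval u b) y))
      value-shiftSub {suc d} l b (c ∷ cs) (m ∷ ms) = begin
        (eval u b - eval u l * eval u m) + y * value (shiftSub l c cs ms)
          ≈⟨ +-congˡ (*-congˡ (value-shiftSub l c cs ms)) ⟩
        (eval u b - eval u l * eval u m) + y * ((eval u c + y * value cs) - eval u l * M + (eval u l - z) * pow y d)
          ≈⟨ solve 9 (λ b l m y c v M z w →
                (b :- l :* m) :+ y :* ((c :+ y :* v) :- l :* M :+ (l :- z) :* w) :=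
                (b :+ y :* (c :+ y :* v)) :- l :* (m :+ y :* M) :+ (l :- z) :* (y :* w)) refl
               (eval u b) (eval u l) (eval u m) y (eval u c) (value cs) M z (pow y d) ⟩
        (eval u b + y * (eval u c + y * value cs)) - eval u l * (eval u m + y * M) + (eval u l - z) * (y * pow y d) ∎
        where
        M = hornerMonic (evalAll ms) y
        z = eval u (lastFrom c cs)

      module _ {d : ℕ} (ms : Vec (Expr n) d) (root : hornerMonic (evalAll ms) y ≈ 0#) where

        value-mulVar : ∀ cs → value (mulVar ms cs) ≈ y * value cs
        value-mulVar cs = begin
          value (mulVar ms cs)
            ≈⟨ value-shiftSub (lastFrom zero cs) zero cs ms ⟩
          (0# + y * value cs) - l * hornerMonic (evalAll ms) y + (l - l) * pow y d
            ≈⟨ +-congʳ (+-congˡ (-‿cong (*-congˡ root))) ⟩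
          (0# + y * value cs) - l * 0# + (l - l) * pow y d
            ≈⟨ solve 3 (λ v l w → (con ℤ.0ℤ :+ v) :- l :* con ℤ.0ℤ :+ (l :- l) :* w := v) refl (y * value cs) l (pow y d) ⟩
          y * value cs ∎
          where l = eval u (lastFrom zero cs)

        value-mulMod : ∀ {e} (bs : Vec (Expr n) e) cs → value (mulMod ms bs cs) ≈ value bs * value cs
        value-mulMod []       cs = trans (value-zeros d) (sym (zeroˡ _))
        value-mulMod (b ∷ bs) cs = begin
          value (mulMod ms (b ∷ bs) cs)
            ≈⟨ value-add (Vec.map (mul b) cs) (mulVar ms (mulMod ms bs cs)) ⟩
          value (Vec.map (mul b) cs) + value (mulVar ms (mulMod ms bs cs))
            ≈⟨ +-cong (value-scale b cs) (trans (value-mulVar (mulMod ms bs cs)) (*-congˡ (value-mulMod bs cs))) ⟩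
          eval u b * value cs + y * (value bs * value cs)
            ≈⟨ solve 4 (λ b v y w → b :* v :+ y :* (w :* v) := (b :+ y :* w) :* v) refl (eval u b) (value cs) y (value bs) ⟩
          (eval u b + y * value bs) * value cs ∎

      -- The remainder does not depend on y, yet it has the right value at every root y of the
      -- modulus. Elimination rests on this uniformity.
      value-reduce : ∀ {d} (ms : Vec (Expr n) (suc d)) → hornerMonic (evalAll ms) y ≈ 0# →
                     ∀ f → value (reduce ms f) ≈ eval (y ∷ u) f
      value-reduce {d} ms root zero          = value-zeros (suc d)
      value-reduce {d} ms root one           = value-constant d one
      value-reduce {d} ms root (var zero)    = begin
        value (mulVar ms (one ∷ zeros d)) ≈⟨ value-mulVar ms root (one ∷ zeros d) ⟩
        y * value (one ∷ zeros d)         ≈⟨ *-congˡ (value-constant d one) ⟩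
        y * 1#                            ≈⟨ *-identityʳ y ⟩
        y                                 ∎
      value-reduce {d} ms root (var (suc i)) = value-constant d (var i)
      value-reduce ms root (add f g)     =
        trans (value-add (reduce ms f) (reduce ms g)) (+-cong (value-reduce ms root f) (value-reduce ms root g))
      value-reduce ms root (mul f g)     =
        trans (value-mulMod ms root (reduce ms f) (reduce ms g)) (*-cong (value-reduce ms root f) (value-reduce ms root g))
      value-reduce ms root (neg f)       = trans (value-neg (reduce ms f)) (-‿cong (value-reduce ms root f))

  module _ {D : ℕ} (m₀ : Vec (Expr 0) D) where

    Root : Carrier → Set
    Root y = hornerMonic (evalAll [] m₀) y ≈ 0#

    DistinctRoots : List Carrier → Set
    DistinctRoots l = AllPairs _≉_ l × All Root l

    DistinctRoots-resp-↭ : ∀ {l l′} → l ↭ l′ → DistinctRoots l → DistinctRoots l′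
    DistinctRoots-resp-↭ p (l≉ , l-roots) =
      PermSetoidₚ.AllPairs-resp-↭ (≡.setoid Carrier) ≉-sym (≡.resp₂ _) (↭⇒↭ₛ p) l≉ , Permₚ.All-resp-↭ p l-roots

    DistinctRoots-++⁻ˡ : ∀ l {l′} → DistinctRoots (l ++ l′) → DistinctRoots l
    DistinctRoots-++⁻ˡ l (l≉ , l-roots) = AllPairs-++⁻ˡ l l≉ , Allₚ.++⁻ˡ l l-roots

    -- m₀ divided by the linear factors of the first j variables
    cofactor : ∀ j s → s ℕ.+ j ≡ D → Vec (Expr j) s
    cofactor zero    s eq = ≡.subst (Vec (Expr 0)) (≡.trans (≡.sym eq) (ℕₚ.+-identityʳ s)) m₀
    cofactor (suc j) s eq =
      quotientE (var zero) (Vec.map weaken (cofactor j (suc s) (≡.trans (≡.sym (ℕₚ.+-suc s j)) eq)))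

    -- By induction the previous cofactor vanishes both at y and at x, the root just divided out.
    -- The division identity then leaves (y - x) times the new cofactor at y equal to 0, and y
    -- differs from x.
    cofactor-root : ∀ j s eq (u : Vec Carrier j) y → DistinctRoots (y ∷ toList u) →
                    hornerMonic (evalAll u (cofactor j s eq)) y ≈ 0#
    cofactor-root zero s eq [] y (_ , y-root ∷ _) = transport (≡.trans (≡.sym eq) (ℕₚ.+-identityʳ s))
      where
      transport : ∀ {s} (D≡s : D ≡ s) → hornerMonic (evalAll [] (≡.subst (Vec (Expr 0)) D≡s m₀)) y ≈ 0#
      transport ≡.refl = y-root
    cofactor-root (suc j) s eq (x ∷ u) y ((y≉x ∷ y≉u) ∷ (x≉u ∷ u≉) , y-root ∷ x-root ∷ u-roots) =
      *-cancel-difference y≉x (begin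
        (y - x) * hornerMonic (evalAll (x ∷ u) (quotientE (var zero) (Vec.map weaken c))) y
          ≈⟨ +-identityʳ _ ⟨
        (y - x) * hornerMonic (evalAll (x ∷ u) (quotientE (var zero) (Vec.map weaken c))) y + 0#
          ≈⟨ +-congˡ (at x (cofactor-root j (suc s) eq′ u x (x≉u ∷ u≉ , x-root ∷ u-roots))) ⟨
        (y - x) * hornerMonic (evalAll (x ∷ u) (quotientE (var zero) (Vec.map weaken c))) y + hornerMonic (evalAll (x ∷ u) (Vec.map weaken c)) x
          ≈⟨ hornerMonic-quotientE (x ∷ u) (var zero) y (Vec.map weaken c) ⟨
        hornerMonic (evalAll (x ∷ u) (Vec.map weaken c)) y
          ≈⟨ at y (cofactor-root j (suc s) eq′ u y (y≉u ∷ u≉ , y-root ∷ u-roots)) ⟩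
        0# ∎)
      where
      eq′ = ≡.trans (≡.sym (ℕₚ.+-suc s j)) eq
      c   = cofactor j (suc s) eq′
      evalAll-weaken : ∀ {d} (cs : Vec (Expr j) d) → evalAll (x ∷ u) (Vec.map weaken cs) ≡ evalAll u cs
      evalAll-weaken []       = ≡.refl
      evalAll-weaken (f ∷ cs) = ≡.cong₂ _∷_ (eval-weaken x u f) (evalAll-weaken cs)
      at : ∀ t → hornerMonic (evalAll u c) t ≈ 0# → hornerMonic (evalAll (x ∷ u) (Vec.map weaken c)) t ≈ 0#
      at t = trans (reflexive (≡.cong (λ cs → hornerMonic cs t) (evalAll-weaken c)))

    module _ (F : List Carrier → Carrier) (F-sym : ∀ {l l′} → l ↭ l′ → F l ≈ F l′)
             (f : Expr D) (F≈f : ∀ v → F (toList v) ≈ eval v f) where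

      -- Once the other entries of w are eliminated, F is a polynomial in an entry y of w and in u;
      -- modulo the cofactor it becomes Σ cᵢ(u) yⁱ with i ≤ s. By symmetry y may be any of the
      -- s + 1 entries of w, so Σ cᵢ(u) tⁱ - F has more roots than its degree, and F = c₀(u).
      eliminate : ∀ s j → s ℕ.+ j ≡ D → Σ (Expr j) λ g → ∀ w (u : Vec Carrier j) → length w ≡ s →
                  DistinctRoots (w ʳ++ toList u) → F (w ʳ++ toList u) ≈ eval u g
      eliminate zero    j ≡.refl = f , λ { [] u _ _ → F≈f u }
      eliminate (suc s) j eq = Vec.head cs , equal
        where
        IH = eliminate s (suc j) (≡.trans (ℕₚ.+-suc s j) eq)
        ms = cofactor j (suc s) eq
        cs = reduce ms (proj₁ IH)
        equal : ∀ w u → length w ≡ suc s → DistinctRoots (w ʳ++ toList u) → F (w ʳ++ toList u) ≈ eval u (Vec.head cs)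
        equal w u |w|≡ distinct = trans (constant-term (evalAll u cs) values) (reflexive (head-evalAll cs))
          where
          F₀ = F (w ʳ++ toList u)
          w-first : DistinctRoots w
          w-first = DistinctRoots-++⁻ˡ w (DistinctRoots-resp-↭ (↭-sym (Permₚ.++↭ʳ++ w (toList u))) distinct)
          value-at : ∀ {y} → y ∈ w → horner (evalAll u cs) y ≈ F₀
          value-at {y} y∈w with ∈-∃++ y∈w
          ... | w₁ , w₂ , ≡.refl = begin
            horner (evalAll u cs) y             ≈⟨ value-reduce u y ms (cofactor-root j (suc s) eq u y prefix) (proj₁ IH) ⟩
            eval (y ∷ u) (proj₁ IH)             ≈⟨ proj₂ IH w′ (y ∷ u) |w′|≡ (DistinctRoots-resp-↭ moved distinct) ⟨
            F (w′ ʳ++ (y ∷ toList u))           ≈⟨ F-sym moved ⟨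
            F₀                                  ∎
            where
            w′ = w₁ ++ w₂
            w↭ : w ↭ y ∷ w′
            w↭ = Permₚ.shift y w₁ w₂
            |w′|≡ : length w′ ≡ s
            |w′|≡ = ℕₚ.suc-injective (≡.trans (≡.sym (Permₚ.↭-length w↭)) |w|≡)
            -- Once y is brought to the front, `(y ∷ w′) ʳ++ toList u` unfolds to
            -- `w′ ʳ++ (y ∷ toList u)`: y has passed from the eliminated entries to the variables.
            moved : w ʳ++ toList u ↭ w′ ʳ++ (y ∷ toList u)
            moved = ↭-trans (↭-sym (Permₚ.++↭ʳ++ w (toList u)))
                     (↭-trans (Permₚ.++⁺ʳ (toList u) w↭) (Permₚ.++↭ʳ++ (y ∷ w′) (toList u)))
            prefix : DistinctRoots (y ∷ toList u)
            prefix = DistinctRoots-++⁻ˡ (y ∷ toList u) (DistinctRoots-resp-↭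
              (↭-trans moved (↭-trans (↭-sym (Permₚ.++↭ʳ++ w′ (y ∷ toList u))) (Permₚ.++-comm w′ (y ∷ toList u)))) distinct)
          values : All (λ y → horner (evalAll u cs) y ≈ F₀) w
          values = All.tabulate value-at
          constant-term : (as : Vec Carrier (suc s)) → All (λ y → horner as y ≈ F₀) w → F₀ ≈ Vec.head as
          -- Subtracting `F₀` from the constant coefficient gives s + 1 coefficients and the s + 1
          -- distinct roots in `w`; the resulting zero function is evaluated at 0, where only a - F₀
          -- survives.
          constant-term (a ∷ as) eqs = sym (x∙y⁻¹≈ε⇒x≈y a F₀ (begin
            a - F₀                     ≈⟨ +-identityʳ _ ⟨
            (a - F₀) + 0#              ≈⟨ +-congˡ (zeroˡ _) ⟨
            (a - F₀) + 0# * horner as 0# ≈⟨ roots⇒zero ((a - F₀) ∷ as) w |w|≡ (proj₁ w-first) (All.map root eqs) 0# ⟩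
            0#                         ∎))
            where
            root : ∀ {y} → a + y * horner as y ≈ F₀ → (a - F₀) + y * horner as y ≈ 0#
            root {y} e = trans (solve 3 (λ a f v → (a :- f) :+ v := (a :+ v) :- f) refl a F₀ (y * horner as y)) (x≈y⇒x∙y⁻¹≈ε e)
          head-evalAll : (cs : Vec (Expr j) (suc s)) → Vec.head (evalAll u cs) ≡ eval u (Vec.head cs)
          head-evalAll (c ∷ cs) = ≡.refl

      -- After all D entries are eliminated the expression is closed, and it can be computed in ℤ.
      symmetric⇒integer : ∀ l → length l ≡ D → DistinctRoots l → ∃ λ i → F l ≈ castℤ i
      symmetric⇒integer l |l|≡D distinct = evalℤ (proj₁ E) , (begin
        F l                     ≈⟨ F-sym l↭ ⟩
        F (l ʳ++ [])            ≈⟨ proj₂ E l [] |l|≡D (DistinctRoots-resp-↭ l↭ distinct) ⟩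
        eval [] (proj₁ E)       ≈⟨ eval-evalℤ (proj₁ E) ⟩
        castℤ (evalℤ (proj₁ E)) ∎)
        where
        E = eliminate D 0 (ℕₚ.+-identityʳ D)
        l↭ : l ↭ l ʳ++ []
        l↭ = ↭-trans (↭-sym (Permₚ.++-identityʳ l)) (Permₚ.++↭ʳ++ l [])

-- Integrality of the characteristic polynomial

-- The default turns each coefficient into a function defined on lists of roots of every length, as
-- the elimination theorem asks.
nth : ∀ {A : Set} → A → List A → ℕ → A
nth d []       i       = d
nth d (x ∷ xs) zero    = x
nth d (x ∷ xs) (suc i) = nth d xs i

nth-map : ∀ {A B : Set} (h : A → B) d xs i → nth (h d) (map h xs) i ≡ h (nth d xs i)
nth-map h d []       i       = ≡.refl
nth-map h d (x ∷ xs) zero    = ≡.refl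
nth-map h d (x ∷ xs) (suc i) = nth-map h d xs i

module _ {A : Set} (_⊕_ : A → A → A) (ε : A) where

  -- The sums of all n-element multisets of entries of the list. The operation is a parameter so
  -- that the same list can be formed in `K` and from formal expressions.
  multisetSums : ℕ → List A → List A
  multisetSums zero    v       = ε ∷ []
  multisetSums (suc n) []      = []
  multisetSums (suc n) (x ∷ v) = map (x ⊕_) (multisetSums n (x ∷ v)) ++ multisetSums (suc n) v

map-multisetSums : ∀ {A B : Set} {_⊕_ : A → A → A} {_⊕′_ : B → B → B} {ε ε′} (h : A → B) →
                   (∀ x y → h (x ⊕ y) ≡ h x ⊕′ h y) → h ε ≡ ε′ →
                   ∀ n v → map h (multisetSums _⊕_ ε n v) ≡ multisetSums _⊕′_ ε′ n (map h v)
map-multisetSums h h-⊕ h-ε zero    v       = ≡.cong (_∷ []) h-ε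
map-multisetSums h h-⊕ h-ε (suc n) []      = ≡.refl
map-multisetSums {_⊕_ = _⊕_} {_⊕′_} {ε} {ε′} h h-⊕ h-ε (suc n) (x ∷ v) = begin
  map h (map (x ⊕_) sums ++ sums′)            ≡⟨ LP.map-++ h (map (x ⊕_) sums) sums′ ⟩
  map h (map (x ⊕_) sums) ++ map h sums′      ≡⟨ ≡.cong₂ _++_ shift (map-multisetSums h h-⊕ h-ε (suc n) v) ⟩
  map (h x ⊕′_) (multisetSums _⊕′_ ε′ n (map h (x ∷ v))) ++ multisetSums _⊕′_ ε′ (suc n) (map h v) ∎
  where
  open ≡.≡-Reasoning
  sums = multisetSums _⊕_ ε n (x ∷ v)
  sums′ = multisetSums _⊕_ ε (suc n) v
  shift : map h (map (x ⊕_) sums) ≡ map (h x ⊕′_) (multisetSums _⊕′_ ε′ n (map h (x ∷ v)))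
  shift = begin
    map h (map (x ⊕_) sums)         ≡⟨ LP.map-∘ sums ⟨
    map (λ s → h (x ⊕ s)) sums      ≡⟨ LP.map-cong (h-⊕ x) sums ⟩
    map (λ s → h x ⊕′ h s) sums     ≡⟨ LP.map-∘ sums ⟩
    map (h x ⊕′_) (map h sums)      ≡⟨ ≡.cong (map (h x ⊕′_)) (map-multisetSums h h-⊕ h-ε n (x ∷ v)) ⟩
    map (h x ⊕′_) (multisetSums _⊕′_ ε′ n (map h (x ∷ v))) ∎

linE : ∀ {n} → Expr n → Expr n → List (Expr n) → List (Expr n)
linE b c []       = c ∷ []
linE b c (d ∷ ds) = add c (neg (mul b d)) ∷ linE b d ds

module Polynomials (K : Char0Domain) where
  open Char0Domain K hiding (zero)
  open CommRing cring
  open Elimination K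
  open Solver using (solve; _:+_; _:*_; _:-_; :-_; con; _:=_)
  import Relation.Binary.Reasoning.Setoid setoid as ≈-Reasoning
  private
    module PS  = PermSetoid setoid
    module PSₚ = PermSetoidₚ setoid

  sums : ℕ → List Carrier → List Carrier
  sums = multisetSums _+_ 0#

  -- A descending tuple is a multiset of exponents written in normal form; splitting by the largest
  -- exponent on one side is splitting by the head of `downFrom` on the other.
  decTuples-sums : ∀ g l b → map (λ t → sumOver t g) (decTuples l b) ↭ sums l (map g (downFrom b))
  decTuples-sums g zero    b       = Perm.refl
  decTuples-sums g (suc l) zero    = Perm.refl
  decTuples-sums g (suc l) (suc b) = ↭-trans (↭-reflexive split) (↭-trans
    (Permₚ.++-comm (map total (decTuples (suc l) b)) _)
    (Permₚ.++⁺ (Permₚ.map⁺ (g b +_) (decTuples-sums g l (suc b))) (decTuples-sums g (suc l) b)))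
    where
    total : List ℕ → Carrier
    total t = sumOver t g
    split : map total (decTuples (suc l) (suc b)) ≡
            map total (decTuples (suc l) b) ++ map (g b +_) (map total (decTuples l (suc b)))
    split = ≡.trans (≡.cong (map total) (decTuples-suc l b))
             (≡.trans (LP.map-++ total (decTuples (suc l) b) _)
               (≡.cong (map total (decTuples (suc l) b) ++_)
                 (≡.trans (≡.sym (LP.map-∘ (decTuples l (suc b)))) (LP.map-∘ (decTuples l (suc b))))))

  translate-↭ : ∀ x {l l′} → l PS.↭ l′ → map (x +_) l PS.↭ map (x +_) l′
  translate-↭ x = PSₚ.map⁺ setoid +-congˡ

  sums-prep : ∀ x {v v′} → (∀ n → sums n v PS.↭ sums n v′) → ∀ n → sums n (x ∷ v) PS.↭ sums n (x ∷ v′)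
  sums-prep x p zero    = PS.↭-refl
  sums-prep x p (suc n) = PSₚ.++⁺ (translate-↭ x (sums-prep x p n)) (p (suc n))

  -- Either list consists of four blocks: the multisets containing both x and y, only x (x + `B`),
  -- only y (y + `C`), and neither (`E`). The first block is matched by induction and by x + (y + s)
  -- ≈ y + (x + s), the reason for permutations up to `≈`.
  sums-swap : ∀ x y v n → sums n (x ∷ y ∷ v) PS.↭ sums n (y ∷ x ∷ v)
  sums-swap x y v zero          = PS.↭-refl
  sums-swap x y v (suc zero)    = PS.↭-swap _ _ PS.↭-refl
  sums-swap x y v (suc (suc n)) = begin
    map (x +_) (sums (suc n) (x ∷ y ∷ v)) ++ (map (y +_) C ++ E)
      ↭⟨ PSₚ.++⁺ʳ _ (translate-↭ x (sums-swap x y v (suc n))) ⟩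
    map (x +_) (map (y +_) A ++ B) ++ (map (y +_) C ++ E)
      ≡⟨ ≡.cong (_++ (map (y +_) C ++ E)) (LP.map-++ (x +_) (map (y +_) A) B) ⟩
    (map (x +_) (map (y +_) A) ++ map (x +_) B) ++ (map (y +_) C ++ E)
      ↭⟨ middle (map (x +_) (map (y +_) A)) (map (x +_) B) (map (y +_) C) E ⟩
    (map (x +_) (map (y +_) A) ++ map (y +_) C) ++ (map (x +_) B ++ E)
      ↭⟨ PSₚ.++⁺ʳ _ (PSₚ.++⁺ʳ _ (PS.↭-trans (PS.refl (exchange A)) (translate-↭ y (translate-↭ x (sums-swap y x v n))))) ⟩
    (map (y +_) (map (x +_) A′) ++ map (y +_) C) ++ (map (x +_) B ++ E)
      ≡⟨ ≡.cong (_++ (map (x +_) B ++ E)) (LP.map-++ (y +_) (map (x +_) A′) C) ⟨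
    map (y +_) (sums (suc n) (x ∷ y ∷ v)) ++ (map (x +_) B ++ E)
      ↭⟨ PSₚ.++⁺ʳ _ (translate-↭ y (sums-swap x y v (suc n))) ⟩
    map (y +_) (sums (suc n) (y ∷ x ∷ v)) ++ (map (x +_) B ++ E) ∎
    where
    open PS.PermutationReasoning
    A  = sums n (y ∷ x ∷ v)
    A′ = sums n (x ∷ y ∷ v)
    B  = sums (suc n) (x ∷ v)
    C  = sums (suc n) (y ∷ v)
    E  = sums (suc (suc n)) v
    exchange : ∀ l → Pointwise _≈_ (map (x +_) (map (y +_) l)) (map (y +_) (map (x +_) l))
    exchange []      = []
    exchange (s ∷ l) = solve 3 (λ x y s → x :+ (y :+ s) := y :+ (x :+ s)) refl x y s ∷ exchange l
    middle : ∀ a b c d → (a ++ b) ++ (c ++ d) PS.↭ (a ++ c) ++ (b ++ d)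
    middle a b c d = begin
      (a ++ b) ++ (c ++ d)   ≡⟨ LP.++-assoc a b (c ++ d) ⟩
      a ++ (b ++ (c ++ d))   ↭⟨ PSₚ.++⁺ˡ a (PSₚ.shifts b c) ⟩
      a ++ (c ++ (b ++ d))   ≡⟨ LP.++-assoc a c (b ++ d) ⟨
      (a ++ c) ++ (b ++ d)   ∎

  sums-↭ : ∀ {v v′} → v ↭ v′ → ∀ n → sums n v PS.↭ sums n v′
  sums-↭ Perm.refl         n = PS.↭-refl
  sums-↭ (Perm.prep x p)   n = sums-prep x (sums-↭ p) n
  sums-↭ (Perm.swap x y p) n = PS.↭-trans (sums-prep x (sums-prep y (sums-↭ p)) n) (sums-swap x y _ n)
  sums-↭ (Perm.trans p q)  n = PS.↭-trans (sums-↭ p n) (sums-↭ q n)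

  -- A polynomial is its list of coefficients, the constant one first; lin b c ds is
  -- (X - b) ds + c, so that lin b 0# multiplies by X - b.
  lin : Carrier → Carrier → List Carrier → List Carrier
  lin b c []       = c ∷ []
  lin b c (d ∷ ds) = (c + - (b * d)) ∷ lin b d ds

  infix 4 _≋_
  _≋_ : List Carrier → List Carrier → Set
  _≋_ = Pointwise _≈_

  ≋-trans : ∀ {cs ds es} → cs ≋ ds → ds ≋ es → cs ≋ es
  ≋-trans = Pointwise.transitive trans

  ≋-refl : ∀ {cs} → cs ≋ cs
  ≋-refl = Pointwise.refl refl

  lin-cong : ∀ {b b′ c c′ ds ds′} → b ≈ b′ → c ≈ c′ → ds ≋ ds′ → lin b c ds ≋ lin b′ c′ ds′
  lin-cong b≈ c≈ []         = c≈ ∷ []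
  lin-cong b≈ c≈ (d≈ ∷ ds≈) = +-cong c≈ (-‿cong (*-cong b≈ d≈)) ∷ lin-cong b≈ d≈ ds≈

  -- Here x and c are the two coefficients preceding `ds`, the state of the recursion; each output
  -- coefficient is symmetric in a and b.
  lin-comm′ : ∀ a b x c ds → lin a (x + - (b * c)) (lin b c ds) ≋ lin b (x + - (a * c)) (lin a c ds)
  lin-comm′ a b x c []       =
    solve 4 (λ a b x c → x :+ :- (b :* c) :+ :- (a :* c) := x :+ :- (a :* c) :+ :- (b :* c)) refl a b x c ∷ refl ∷ []
  lin-comm′ a b x c (d ∷ ds) =
    solve 5 (λ a b x c d → x :+ :- (b :* c) :+ :- (a :* (c :+ :- (b :* d))) := x :+ :- (a :* c) :+ :- (b :* (c :+ :- (a :* d)))) refl a b x c d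
    ∷ lin-comm′ a b c d ds

  lin-comm : ∀ a b ds → lin a 0# (lin b 0# ds) ≋ lin b 0# (lin a 0# ds)
  lin-comm a b ds = ≋-trans (lin-cong refl (absorb b) ≋-refl)
    (≋-trans (lin-comm′ a b 0# 0# ds) (lin-cong refl (sym (absorb a)) ≋-refl))
    where
    absorb : ∀ b → 0# ≈ 0# + - (b * 0#)
    absorb = solve 1 (λ b → con ℤ.0ℤ := con ℤ.0ℤ :+ :- (b :* con ℤ.0ℤ)) refl

  linProduct : List Carrier → List Carrier
  linProduct = foldr (λ b cs → lin b 0# cs) (1# ∷ [])

  linProduct-≋ : ∀ {bs bs′} → bs ≋ bs′ → linProduct bs ≋ linProduct bs′
  linProduct-≋ []        = ≋-refl
  linProduct-≋ (b≈ ∷ bs≈) = lin-cong b≈ refl (linProduct-≋ bs≈)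

  linProduct-↭ : ∀ {bs bs′} → bs PS.↭ bs′ → linProduct bs ≋ linProduct bs′
  linProduct-↭ (PS.refl bs≈)      = linProduct-≋ bs≈
  linProduct-↭ (PS.prep b≈ p)     = lin-cong b≈ refl (linProduct-↭ p)
  linProduct-↭ (PS.swap {xs} {ys} {x} {y} {x′} {y′} x≈ y≈ p) =
    ≋-trans (lin-comm x y (linProduct xs)) (lin-cong y≈ refl (lin-cong x≈ refl (linProduct-↭ p)))
  linProduct-↭ (PS.trans p q)     = ≋-trans (linProduct-↭ p) (linProduct-↭ q)

  evalL : List Carrier → Carrier → Carrier
  evalL []       t = 0#
  evalL (c ∷ cs) t = c + t * evalL cs t

  evalL-lin′ : ∀ b c ds t → evalL (lin b c ds) t ≈ (c + t * evalL ds t) - b * evalL ds t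
  evalL-lin′ b c []       t = solve 3 (λ b c t → c :+ t :* con ℤ.0ℤ := (c :+ t :* con ℤ.0ℤ) :- b :* con ℤ.0ℤ) refl b c t
  evalL-lin′ b c (d ∷ ds) t = trans (+-congˡ (*-congˡ (evalL-lin′ b d ds t)))
    (solve 5 (λ b c d t v → c :+ :- (b :* d) :+ t :* ((d :+ t :* v) :- b :* v) := (c :+ t :* (d :+ t :* v)) :- b :* (d :+ t :* v)) refl
      b c d t (evalL ds t))

  evalL-lin : ∀ b ds t → evalL (lin b 0# ds) t ≈ (t - b) * evalL ds t
  evalL-lin b ds t = trans (evalL-lin′ b 0# ds t)
    (solve 3 (λ b t v → (con ℤ.0ℤ :+ t :* v) :- b :* v := (t :- b) :* v) refl b t (evalL ds t))

  linProduct-root : ∀ {b t} bs → b ∈ bs → t ≈ b → evalL (linProduct bs) t ≈ 0#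
  linProduct-root {b} {t} (b ∷ bs) (here ≡.refl) t≈b = begin
    evalL (lin b 0# (linProduct bs)) t     ≈⟨ evalL-lin b (linProduct bs) t ⟩
    (t - b) * evalL (linProduct bs) t      ≈⟨ *-congʳ (trans (+-congʳ t≈b) (-‿inverseʳ b)) ⟩
    0# * evalL (linProduct bs) t           ≈⟨ zeroˡ _ ⟩
    0#                                     ∎
    where open ≈-Reasoning
  linProduct-root {b} {t} (b′ ∷ bs) (there b∈) t≈b = begin
    evalL (lin b′ 0# (linProduct bs)) t    ≈⟨ evalL-lin b′ (linProduct bs) t ⟩
    (t - b′) * evalL (linProduct bs) t     ≈⟨ *-congˡ (linProduct-root bs b∈ t≈b) ⟩
    (t - b′) * 0#                          ≈⟨ zeroʳ _ ⟩
    0#                                     ∎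
    where open ≈-Reasoning

  nth-≋ : ∀ {cs ds} → cs ≋ ds → ∀ i → nth 0# cs i ≈ nth 0# ds i
  nth-≋ []         i       = refl
  nth-≋ (c≈ ∷ cs≈) zero    = c≈
  nth-≋ (c≈ ∷ cs≈) (suc i) = nth-≋ cs≈ i

  sumProduct : ℕ → List Carrier → List Carrier
  sumProduct n v = linProduct (map (1# +_) (sums n v))

  sumProduct-↭ : ∀ n {v v′} → v ↭ v′ → sumProduct n v ≋ sumProduct n v′
  sumProduct-↭ n p = linProduct-↭ (translate-↭ 1# (sums-↭ p n))

  private
    linProductE : ∀ {D} → List (Expr D) → List (Expr D)
    linProductE = foldr (λ b cs → linE b zero cs) (one ∷ [])

    varsE : ∀ D → List (Expr D)
    varsE D = map var (List.allFin D)

  eval-linE : ∀ {D} (v : Vec Carrier D) b c ds →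
              map (eval v) (linE b c ds) ≡ lin (eval v b) (eval v c) (map (eval v) ds)
  eval-linE v b c []       = ≡.refl
  eval-linE v b c (d ∷ ds) = ≡.cong (_ ∷_) (eval-linE v b d ds)

  eval-linProductE : ∀ {D} (v : Vec Carrier D) bs →
                     map (eval v) (linProductE bs) ≡ linProduct (map (eval v) bs)
  eval-linProductE v []       = ≡.refl
  eval-linProductE v (b ∷ bs) =
    ≡.trans (eval-linE v b zero (linProductE bs)) (≡.cong (lin (eval v b) 0#) (eval-linProductE v bs))

  eval-varsE : ∀ {D} (v : Vec Carrier D) → map (eval v) (varsE D) ≡ toList v
  eval-varsE {D} v = ≡.trans (≡.sym (LP.map-∘ (List.allFin D)))
    (≡.trans (LP.map-tabulate (λ i → i) (Vec.lookup v)) (tabulate-lookup v))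
    where
    tabulate-lookup : ∀ {n} (v : Vec Carrier n) → List.tabulate (Vec.lookup v) ≡ toList v
    tabulate-lookup []      = ≡.refl
    tabulate-lookup (x ∷ v) = ≡.cong (x ∷_) (tabulate-lookup v)

  -- Each coefficient is symmetric in the entries of the list, and it is polynomial because the
  -- whole construction, replayed on formal variables, commutes with evaluation.
  sumProduct-integer : ∀ {D} (m₀ : Vec (Expr 0) D) n l → length l ≡ D → DistinctRoots m₀ l →
                       ∀ i → ∃ λ j → nth 0# (sumProduct n l) i ≈ castℤ j
  sumProduct-integer {D} m₀ n l |l|≡D distinct i =
    symmetric⇒integer m₀ (λ v → nth 0# (sumProduct n v) i) (λ p → nth-≋ (sumProduct-↭ n p) i)
      (nth zero coeffsE i) (λ v → reflexive (≡.trans (≡.cong (λ cs → nth 0# cs i) (≡.sym (eval-coeffsE v))) (nth-map (eval v) zero coeffsE i)))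
      l |l|≡D distinct
    where
    coeffsE : List (Expr D)
    coeffsE = linProductE (map (add one) (multisetSums add zero n (varsE D)))
    eval-coeffsE : ∀ v → map (eval v) coeffsE ≡ sumProduct n (toList v)
    eval-coeffsE v = begin
      map (eval v) coeffsE
        ≡⟨ eval-linProductE v (map (add one) sumsE) ⟩
      linProduct (map (eval v) (map (add one) sumsE))
        ≡⟨ ≡.cong linProduct (≡.trans (≡.sym (LP.map-∘ sumsE)) (LP.map-∘ sumsE)) ⟩
      linProduct (map (1# +_) (map (eval v) sumsE))
        ≡⟨ ≡.cong (λ s → linProduct (map (1# +_) s)) (map-multisetSums (eval v) (λ _ _ → ≡.refl) ≡.refl n (varsE D)) ⟩
      sumProduct n (map (eval v) (varsE D))
        ≡⟨ ≡.cong (sumProduct n) (eval-varsE v) ⟩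
      sumProduct n (toList v) ∎
      where
      open ≡.≡-Reasoning
      sumsE = multisetSums add zero n (varsE D)

  -- The polynomial in the shift operator, applied to s and read at index 0. On a geometric sequence
  -- it gives the value of the polynomial at the ratio.
  evalRec : (ℕ → Carrier) → List Carrier → Carrier
  evalRec s []       = 0#
  evalRec s (c ∷ cs) = c * s 0 + evalRec (s ∘ suc) cs

  zipWith-upTo≡evalRec : ∀ (s : ℕ → Carrier) f cs → sumL (List.zipWith (λ i c → c * s i) (List.applyUpTo f (length cs)) cs) ≡ evalRec (s ∘ f) cs
  zipWith-upTo≡evalRec s f []       = ≡.refl
  zipWith-upTo≡evalRec s f (c ∷ cs) = ≡.cong (c * s (f 0) +_) (zipWith-upTo≡evalRec s (f ∘ suc) cs)

  evalRec-cong : ∀ {s t} → (∀ i → s i ≈ t i) → ∀ cs → evalRec s cs ≈ evalRec t cs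
  evalRec-cong s≈t []       = refl
  evalRec-cong s≈t (c ∷ cs) = +-cong (*-congˡ (s≈t 0)) (evalRec-cong (s≈t ∘ suc) cs)

  evalRec-*ˡ : ∀ x s cs → evalRec (λ i → x * s i) cs ≈ x * evalRec s cs
  evalRec-*ˡ x s []       = sym (zeroʳ x)
  evalRec-*ˡ x s (c ∷ cs) = trans (+-congˡ (evalRec-*ˡ x (s ∘ suc) cs))
    (solve 4 (λ c x y r → c :* (x :* y) :+ x :* r := x :* (c :* y :+ r)) refl c x (s 0) (evalRec (s ∘ suc) cs))

  evalRec-sum : ∀ {A : Set} (xs : List A) (s : A → ℕ → Carrier) cs →
                evalRec (λ i → sumOver xs (λ x → s x i)) cs ≈ sumOver xs (λ x → evalRec (s x) cs)
  evalRec-sum xs s []       = sym (sum-0 xs (λ _ _ → refl))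
  evalRec-sum xs s (c ∷ cs) = trans (+-cong (sym (sum-*ˡ c xs (λ x → s x 0))) (evalRec-sum xs (λ x → s x ∘ suc) cs))
    (sym (sum-+ xs (λ x → c * s x 0) (λ x → evalRec (s x ∘ suc) cs)))

  evalRec-geometric : ∀ x b cs → evalRec (λ i → x * pow b i) cs ≈ x * evalL cs b
  evalRec-geometric x b []       = sym (zeroʳ x)
  evalRec-geometric x b (c ∷ cs) = begin
    c * (x * 1#) + evalRec (λ i → x * (b * pow b i)) cs
      ≈⟨ +-cong (*-congˡ (*-identityʳ x)) (evalRec-cong (λ i → sym (*-assoc x b (pow b i))) cs) ⟩
    c * x + evalRec (λ i → (x * b) * pow b i) cs
      ≈⟨ +-congˡ (evalRec-geometric (x * b) b cs) ⟩
    c * x + (x * b) * evalL cs b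
      ≈⟨ solve 4 (λ c x b v → c :* x :+ (x :* b) :* v := x :* (c :+ b :* v)) refl c x b (evalL cs b) ⟩
    x * (c + b * evalL cs b) ∎
    where open ≈-Reasoning

-- Fourier inversion on (ℤ/D)ˡ

length-increments : ∀ ms {ms′} → ms′ ∈ increments ms → length ms′ ≡ length ms
length-increments (m ∷ ms) (here ≡.refl) = ≡.refl
length-increments (m ∷ ms) (there ms′∈) with ∈-map⁻ _ ms′∈
... | _ , ms″∈ , ≡.refl = ≡.cong suc (length-increments ms ms″∈)

module Fourier (K : Char0Domain) (D : ℕ) {{D≢0 : NonZero D}} (root : PrimRoot K D) where
  open Char0Domain K hiding (zero)
  open PrimRoot root using (ζ; ζ^D; ζ-prim)
  open CommRing cring
  open RingProperties ring using (x∙y⁻¹≈ε⇒x≈y)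
  open Solver using (solve; _:+_; _:*_; _:-_; :-_; con; _:=_)
  open import Relation.Binary.Reasoning.Setoid setoid

  sum-allTuples-suc : ∀ l b f → sumOver (allTuples (suc l) b) f ≈ sumOver (upTo b) (λ j → sumOver (allTuples l b) (λ t → f (j ∷ t)))
  sum-allTuples-suc l b f = trans (sum-concatMap (λ j → map (j ∷_) (allTuples l b)) (upTo b) f)
    (sum-cong (upTo b) (λ j → reflexive (sum-map (j ∷_) (allTuples l b) f)))

  -- Multiplication by ζ^(D-i), the inverse of ζ^i, would turn equality into ζ^(j-i) = 1, against
  -- primitivity.
  pow-≉ : ∀ {i j} → i < j → j < D → pow ζ i ≉ pow ζ j
  pow-≉ {i} {j} i<j j<D ζ^i≈ζ^j = ζ-prim (j ∸ i) (ℕₚ.m<n⇒0<n∸m i<j) (ℕₚ.≤-<-trans (ℕₚ.m∸n≤m j i) j<D) (begin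
    pow ζ (j ∸ i)                    ≈⟨ *-identityˡ _ ⟨
    1# * pow ζ (j ∸ i)               ≈⟨ *-congʳ ζ^D ⟨
    pow ζ D * pow ζ (j ∸ i)          ≈⟨ pow-+ ζ D (j ∸ i) ⟨
    pow ζ (D ℕ.+ (j ∸ i))            ≡⟨ ≡.cong (pow ζ) exponents ⟩
    pow ζ ((D ∸ i) ℕ.+ j)            ≈⟨ pow-+ ζ (D ∸ i) j ⟩
    pow ζ (D ∸ i) * pow ζ j          ≈⟨ *-congˡ ζ^i≈ζ^j ⟨
    pow ζ (D ∸ i) * pow ζ i          ≈⟨ pow-+ ζ (D ∸ i) i ⟨
    pow ζ ((D ∸ i) ℕ.+ i)            ≡⟨ ≡.cong (pow ζ) (ℕₚ.m∸n+n≡m i≤D) ⟩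
    pow ζ D                          ≈⟨ ζ^D ⟩
    1#                               ∎)
    where
    i≤D = ℕₚ.<⇒≤ (ℕₚ.<-trans i<j j<D)
    exponents : D ℕ.+ (j ∸ i) ≡ (D ∸ i) ℕ.+ j
    exponents = ≡.trans (≡.cong (ℕ._+ (j ∸ i)) (≡.sym (ℕₚ.m∸n+n≡m i≤D)))
      (≡.trans (ℕₚ.+-assoc (D ∸ i) i (j ∸ i)) (≡.cong ((D ∸ i) ℕ.+_) (ℕₚ.m+[n∸m]≡n (ℕₚ.<⇒≤ i<j))))

  pow-≢⇒≉ : ∀ {i j} → i < D → j < D → i ≢ j → pow ζ i ≉ pow ζ j
  pow-≢⇒≉ {i} {j} i<D j<D i≢j with ℕₚ.<-cmp i j
  ... | tri< i<j _ _ = pow-≉ i<j j<D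
  ... | tri≈ _ i≡j _ = ⊥-elim (i≢j i≡j)
  ... | tri> _ _ j<i = pow-≉ j<i i<D ∘ sym

  pow^D : ∀ i → pow (pow ζ i) D ≈ 1#
  pow^D i = begin
    pow (pow ζ i) D      ≈⟨ pow-* ζ D i ⟨
    pow ζ (D ℕ.* i)      ≡⟨ ≡.cong (pow ζ) (ℕₚ.*-comm D i) ⟩
    pow ζ (i ℕ.* D)      ≈⟨ pow-* ζ i D ⟩
    pow (pow ζ D) i      ≈⟨ pow-cong i ζ^D ⟩
    pow 1# i             ≈⟨ pow-1# i ⟩
    1#                   ∎

  pow-% : ∀ m → pow ζ m ≈ pow ζ (m % D)
  pow-% m = begin
    pow ζ m                                     ≡⟨ ≡.cong (pow ζ) (m≡m%n+[m/n]*n m D) ⟩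
    pow ζ (m % D ℕ.+ m / D ℕ.* D)               ≈⟨ pow-+ ζ (m % D) (m / D ℕ.* D) ⟩
    pow ζ (m % D) * pow ζ (m / D ℕ.* D)         ≈⟨ *-congˡ (trans (pow-* ζ (m / D) D) (trans (pow-cong (m / D) ζ^D) (pow-1# (m / D)))) ⟩
    pow ζ (m % D) * 1#                          ≈⟨ *-identityʳ _ ⟩
    pow ζ (m % D)                               ∎

  -- The quotient of xⁿ - yⁿ by x - y, times y. The exponent n - j, in place of n - 1 - j, comes
  -- from writing ξ^(-j) as ζ^(D-j).
  geometric : Carrier → Carrier → ℕ → Carrier
  geometric x y n = sumOver (upTo n) (λ j → pow x j * pow y (n ∸ j))

  geometric-suc : ∀ x y n → geometric x y (suc n) ≈ y * geometric x y n + pow x n * y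
  geometric-suc x y n = begin
    geometric x y (suc n)
      ≈⟨ sum-upTo-suc n _ ⟩
    sumOver (upTo n) (λ j → pow x j * pow y (suc n ∸ j)) + pow x n * pow y (suc n ∸ n)
      ≈⟨ +-cong (sum-upTo-cong n lower) (*-congˡ (trans (reflexive (≡.cong (pow y) (ℕₚ.m+n∸n≡m 1 n))) (*-identityʳ y))) ⟩
    sumOver (upTo n) (λ j → y * (pow x j * pow y (n ∸ j))) + pow x n * y
      ≈⟨ +-congʳ (sum-*ˡ y (upTo n) _) ⟩
    y * geometric x y n + pow x n * y ∎
    where
    lower : ∀ j → j < n → pow x j * pow y (suc n ∸ j) ≈ y * (pow x j * pow y (n ∸ j))
    lower j j<n = trans (*-congˡ (reflexive (≡.cong (pow y) (ℕₚ.+-∸-assoc 1 (ℕₚ.<⇒≤ j<n)))))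
      (solve 3 (λ a y b → a :* (y :* b) := y :* (a :* b)) refl (pow x j) y (pow y (n ∸ j)))

  geometric-difference : ∀ x y n → (x - y) * geometric x y n ≈ y * (pow x n - pow y n)
  geometric-difference x y zero    = solve 3 (λ x y i → (x :- y) :* con ℤ.0ℤ := y :* (i :- i)) refl x y 1#
    where import Data.Integer as ℤ
  geometric-difference x y (suc n) = begin
    (x - y) * geometric x y (suc n)
      ≈⟨ *-congˡ (geometric-suc x y n) ⟩
    (x - y) * (y * g + X * y)
      ≈⟨ solve 4 (λ x y g X → (x :- y) :* (y :* g :+ X :* y) := y :* ((x :- y) :* g) :+ (x :- y) :* X :* y) refl x y g X ⟩
    y * ((x - y) * g) + (x - y) * X * y
      ≈⟨ +-congʳ (*-congˡ (geometric-difference x y n)) ⟩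
    y * (y * (X - Y)) + (x - y) * X * y
      ≈⟨ solve 4 (λ x y X Y → y :* (y :* (X :- Y)) :+ (x :- y) :* X :* y := y :* (x :* X :- y :* Y)) refl x y X Y ⟩
    y * (x * X - y * Y) ∎
    where
    g = geometric x y n
    X = pow x n
    Y = pow y n

  -- Both arguments are D-th roots of unity, so their difference annihilates the sum; it is nonzero,
  -- since m may be replaced by `m % D` in the exponent.
  orthogonality-≢ : ∀ b m → b < D → b ≢ m % D → geometric (pow ζ b) (pow ζ m) D ≈ 0#
  orthogonality-≢ b m b<D b≢m
    with noZeroDiv (pow ζ b - pow ζ m) (geometric (pow ζ b) (pow ζ m) D) (begin
      (pow ζ b - pow ζ m) * geometric (pow ζ b) (pow ζ m) D       ≈⟨ geometric-difference (pow ζ b) (pow ζ m) D ⟩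
      pow ζ m * (pow (pow ζ b) D - pow (pow ζ m) D)               ≈⟨ *-congˡ (+-cong (pow^D b) (-‿cong (pow^D m))) ⟩
      pow ζ m * (1# - 1#)                                         ≈⟨ *-congˡ (-‿inverseʳ 1#) ⟩
      pow ζ m * 0#                                                ≈⟨ zeroʳ _ ⟩
      0#                                                          ∎)
  ... | inj₁ eq  = ⊥-elim (pow-≢⇒≉ b<D (m%n<n m D) b≢m (trans (x∙y⁻¹≈ε⇒x≈y _ _ eq) (pow-% m)))
  ... | inj₂ g≈0 = g≈0

  orthogonality-≡ : ∀ m → geometric (pow ζ (m % D)) (pow ζ m) D ≈ castℕ D
  orthogonality-≡ m = trans (sum-upTo-cong D one-each) (count D)
    where
    one-each : ∀ j → j < D → pow (pow ζ (m % D)) j * pow (pow ζ m) (D ∸ j) ≈ 1#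
    one-each j j<D = begin
      pow (pow ζ (m % D)) j * pow (pow ζ m) (D ∸ j)  ≈⟨ *-congʳ (pow-cong j (pow-% m)) ⟨
      pow (pow ζ m) j * pow (pow ζ m) (D ∸ j)        ≈⟨ pow-+ (pow ζ m) j (D ∸ j) ⟨
      pow (pow ζ m) (j ℕ.+ (D ∸ j))                  ≡⟨ ≡.cong (pow (pow ζ m)) (ℕₚ.m+[n∸m]≡n (ℕₚ.<⇒≤ j<D)) ⟩
      pow (pow ζ m) D                                ≈⟨ pow^D m ⟩
      1#                                             ∎
    count : ∀ n → sumOver (upTo n) (λ _ → 1#) ≈ castℕ n
    count zero    = refl
    count (suc n) = trans (sum-upTo-suc n _) (trans (+-congʳ (count n)) (+-comm _ _))

  -- Summing over j first leaves, by orthogonality, only b = `m % D`, with weight D.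
  inversion₁ : ∀ (g : ℕ → Carrier) → (∀ m → g m ≈ g (m % D)) → ∀ m →
    sumOver (upTo D) (λ j → sumOver (upTo D) (λ b → (pow ζ (j ℕ.* b) * pow ζ ((D ∸ j) ℕ.* m)) * g b)) ≈ castℕ D * g m
  inversion₁ g g-% m = begin
    sumOver (upTo D) (λ j → sumOver (upTo D) (λ b → (pow ζ (j ℕ.* b) * pow ζ ((D ∸ j) ℕ.* m)) * g b))
      ≈⟨ sum-swap (upTo D) (upTo D) _ ⟩
    sumOver (upTo D) (λ b → sumOver (upTo D) (λ j → (pow ζ (j ℕ.* b) * pow ζ ((D ∸ j) ℕ.* m)) * g b))
      ≈⟨ sum-cong (upTo D) (λ b → trans (sum-*ʳ (g b) (upTo D) _)
           (*-congʳ (sum-cong (upTo D) (λ j → *-cong (pow-* ζ j b) (pow-* ζ (D ∸ j) m))))) ⟩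
    sumOver (upTo D) (λ b → geometric (pow ζ b) (pow ζ m) D * g b)
      ≈⟨ sum-upTo-δ D (m % D) (m%n<n m D) (λ b b<D b≢m → trans (*-congʳ (orthogonality-≢ b m b<D b≢m)) (zeroˡ _)) ⟩
    geometric (pow ζ (m % D)) (pow ζ m) D * g (m % D)
      ≈⟨ *-cong (orthogonality-≡ m) (sym (g-% m)) ⟩
    castℕ D * g m ∎

  character : List ℕ → List ℕ → Carrier
  character js ms = pow ζ (ℕsum (zipWith ℕ._*_ js ms))

  -- Represents -j modulo D; the entry 0 becomes D, with the same power of ζ.
  dual : List ℕ → List ℕ
  dual = map (D ∸_)

  transform : ℕ → (List ℕ → Carrier) → List ℕ → Carrier
  transform l G js = sumOver (allTuples l D) (λ bs → G bs * character js bs)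

  Periodic : (List ℕ → Carrier) → Set
  Periodic G = ∀ {ms ns} → Pointwise (λ m n → m % D ≡ n % D) ms ns → G ms ≈ G ns

  inversion : ∀ l G → Periodic G → ∀ ms → length ms ≡ l →
    sumOver (allTuples l D) (λ js → transform l G js * character (dual js) ms) ≈ pow (castℕ D) l * G ms
  inversion zero    G _          []       _  =
    trans (+-identityʳ _) (trans (*-congʳ (+-identityʳ _)) (trans (*-identityʳ _) (trans (*-identityʳ _) (sym (*-identityˡ _)))))
  inversion (suc l) G G-periodic (m ∷ ms) eq = begin
    sumOver (allTuples (suc l) D) (λ js → transform (suc l) G js * character (dual js) (m ∷ ms))
      ≈⟨ sum-allTuples-suc l D _ ⟩
    sumOver (upTo D) (λ j → sumOver (allTuples l D) (λ js → transform (suc l) G (j ∷ js) * character (dual (j ∷ js)) (m ∷ ms)))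
      ≈⟨ sum-cong (upTo D) (λ j → trans (sum-cong (allTuples l D) (split j)) (sum-swap (allTuples l D) (upTo D) _)) ⟩
    sumOver (upTo D) (λ j → sumOver (upTo D) (λ b → sumOver (allTuples l D) (λ js → w j b * (transform l (G ∘ (b ∷_)) js * character (dual js) ms))))
      ≈⟨ sum-cong (upTo D) (λ j → sum-cong (upTo D) (λ b → trans (sum-*ˡ (w j b) (allTuples l D) _)
           (*-congˡ (inversion l (G ∘ (b ∷_)) (λ eqs → G-periodic (≡.refl ∷ eqs)) ms (ℕₚ.suc-injective eq))))) ⟩
    sumOver (upTo D) (λ j → sumOver (upTo D) (λ b → w j b * (pow (castℕ D) l * G (b ∷ ms))))
      ≈⟨ inversion₁ (λ b → pow (castℕ D) l * G (b ∷ ms))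
           (λ b → *-congˡ (G-periodic (≡.sym (m%n%n≡m%n b D) ∷ Pointwise.refl ≡.refl))) m ⟩
    castℕ D * (pow (castℕ D) l * G (m ∷ ms))
      ≈⟨ *-assoc _ _ _ ⟨
    pow (castℕ D) (suc l) * G (m ∷ ms) ∎
    where
    w : ℕ → ℕ → Carrier
    w j b = pow ζ (j ℕ.* b) * pow ζ ((D ∸ j) ℕ.* m)
    transform-suc : ∀ j js → transform (suc l) G (j ∷ js) ≈ sumOver (upTo D) (λ b → pow ζ (j ℕ.* b) * transform l (G ∘ (b ∷_)) js)
    transform-suc j js = trans (sum-allTuples-suc l D _) (sum-cong (upTo D) λ b →
      trans (sum-cong (allTuples l D) λ bs → trans (*-congˡ (pow-+ ζ (j ℕ.* b) _))
              (solve 3 (λ g x y → g :* (x :* y) := x :* (g :* y)) refl (G (b ∷ bs)) (pow ζ (j ℕ.* b)) (character js bs)))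
            (sum-*ˡ (pow ζ (j ℕ.* b)) (allTuples l D) _))
    split : ∀ j js → transform (suc l) G (j ∷ js) * character (dual (j ∷ js)) (m ∷ ms) ≈
                     sumOver (upTo D) (λ b → w j b * (transform l (G ∘ (b ∷_)) js * character (dual js) ms))
    split j js = begin
      transform (suc l) G (j ∷ js) * character (dual (j ∷ js)) (m ∷ ms)
        ≈⟨ *-cong (transform-suc j js) (pow-+ ζ ((D ∸ j) ℕ.* m) _) ⟩
      sumOver (upTo D) (λ b → pow ζ (j ℕ.* b) * transform l (G ∘ (b ∷_)) js) * (pow ζ ((D ∸ j) ℕ.* m) * character (dual js) ms)
        ≈⟨ sum-*ʳ _ (upTo D) _ ⟨
      sumOver (upTo D) (λ b → (pow ζ (j ℕ.* b) * transform l (G ∘ (b ∷_)) js) * (pow ζ ((D ∸ j) ℕ.* m) * character (dual js) ms))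
        ≈⟨ sum-cong (upTo D) (λ b → solve 4 (λ x t y c → (x :* t) :* (y :* c) := (x :* y) :* (t :* c)) refl
             (pow ζ (j ℕ.* b)) (transform l (G ∘ (b ∷_)) js) (pow ζ ((D ∸ j) ℕ.* m)) (character (dual js) ms)) ⟩
      sumOver (upTo D) (λ b → w j b * (transform l (G ∘ (b ∷_)) js * character (dual js) ms)) ∎

  character-zeros : ∀ js n → character js (List.replicate n 0) ≈ 1#
  character-zeros []       n       = refl
  character-zeros (j ∷ js) zero    = refl
  character-zeros (j ∷ js) (suc n) = trans (reflexive (≡.cong (λ x → pow ζ (x ℕ.+ ℕsum (zipWith ℕ._*_ js (List.replicate n 0)))) (ℕₚ.*-zeroʳ j))) (character-zeros js n)

  dualSum : List ℕ → Carrier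
  dualSum js = sumOver js (λ j → pow ζ (D ∸ j))

  -- Raising mᵢ by one multiplies the character by ζ^(D-jᵢ), so characters are eigenvectors of
  -- summation over increments.
  character-increments : ∀ js ms → length js ≡ length ms →
    sumOver (increments ms) (character (dual js)) ≈ dualSum js * character (dual js) ms
  character-increments []       []       _  = sym (zeroˡ _)
  character-increments (j ∷ js) (m ∷ ms) eq = begin
    pow ζ ((D ∸ j) ℕ.* suc m ℕ.+ s) + sumOver (map (m ∷_) (increments ms)) (character (dual (j ∷ js)))
      ≈⟨ +-cong first (trans (reflexive (sum-map (m ∷_) (increments ms) _)) others) ⟩
    z * (pow ζ ((D ∸ j) ℕ.* m) * character (dual js) ms) + pow ζ ((D ∸ j) ℕ.* m) * (dualSum js * character (dual js) ms)
      ≈⟨ solve 4 (λ z x c d → z :* (x :* c) :+ x :* (d :* c) := (z :+ d) :* (x :* c)) refl z (pow ζ ((D ∸ j) ℕ.* m)) (character (dual js) ms) (dualSum js) ⟩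
    (z + dualSum js) * (pow ζ ((D ∸ j) ℕ.* m) * character (dual js) ms)
      ≈⟨ *-congˡ (pow-+ ζ ((D ∸ j) ℕ.* m) s) ⟨
    (z + dualSum js) * pow ζ ((D ∸ j) ℕ.* m ℕ.+ s) ∎
    where
    z = pow ζ (D ∸ j)
    s = ℕsum (zipWith ℕ._*_ (dual js) ms)
    first : pow ζ ((D ∸ j) ℕ.* suc m ℕ.+ s) ≈ z * (pow ζ ((D ∸ j) ℕ.* m) * character (dual js) ms)
    first = begin
      pow ζ ((D ∸ j) ℕ.* suc m ℕ.+ s)                   ≡⟨ ≡.cong (pow ζ) (≡.trans (≡.cong (ℕ._+ s) (ℕₚ.*-suc (D ∸ j) m)) (ℕₚ.+-assoc (D ∸ j) _ s)) ⟩
      pow ζ ((D ∸ j) ℕ.+ ((D ∸ j) ℕ.* m ℕ.+ s))         ≈⟨ pow-+ ζ (D ∸ j) _ ⟩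
      z * pow ζ ((D ∸ j) ℕ.* m ℕ.+ s)                   ≈⟨ *-congˡ (pow-+ ζ ((D ∸ j) ℕ.* m) s) ⟩
      z * (pow ζ ((D ∸ j) ℕ.* m) * character (dual js) ms) ∎
    others : sumOver (increments ms) (λ ms′ → character (dual (j ∷ js)) (m ∷ ms′)) ≈
             pow ζ ((D ∸ j) ℕ.* m) * (dualSum js * character (dual js) ms)
    others = trans (sum-cong (increments ms) (λ ms′ → pow-+ ζ ((D ∸ j) ℕ.* m) _))
      (trans (sum-*ˡ (pow ζ ((D ∸ j) ℕ.* m)) (increments ms) _) (*-congˡ (character-increments js ms (ℕₚ.suc-injective eq))))

  -- Characters are eigenvectors of the operator W n ↦ W (suc n).
  walk : ∀ l G → Periodic G → (W : ℕ → List ℕ → Carrier) → (∀ ms → W 0 ms ≈ G ms) →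
    (∀ n ms → length ms ≡ l → W (suc n) ms ≈ W n ms + sumOver (increments ms) (W n)) →
    ∀ n ms → length ms ≡ l → pow (castℕ D) l * W n ms ≈
      sumOver (allTuples l D) (λ js → (transform l G js * character (dual js) ms) * pow (1# + dualSum js) n)
  walk l G G-periodic W W-zero W-suc zero    ms |ms|≡l = begin
    pow (castℕ D) l * W 0 ms
      ≈⟨ *-congˡ (W-zero ms) ⟩
    pow (castℕ D) l * G ms
      ≈⟨ inversion l G G-periodic ms |ms|≡l ⟨
    sumOver (allTuples l D) (λ js → transform l G js * character (dual js) ms)
      ≈⟨ sum-cong (allTuples l D) (λ js → *-identityʳ _) ⟨
    sumOver (allTuples l D) (λ js → (transform l G js * character (dual js) ms) * 1#) ∎
  walk l G G-periodic W W-zero W-suc (suc n) ms |ms|≡l = begin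
    D^l * W (suc n) ms
      ≈⟨ *-congˡ (W-suc n ms |ms|≡l) ⟩
    D^l * (W n ms + sumOver (increments ms) (W n))
      ≈⟨ trans (distribˡ _ _ _) (+-congˡ (sym (sum-*ˡ D^l (increments ms) _))) ⟩
    D^l * W n ms + sumOver (increments ms) (λ ms′ → D^l * W n ms′)
      ≈⟨ +-cong (walk l G G-periodic W W-zero W-suc n ms |ms|≡l) (sum-cong-∈ (increments ms) (λ ms′ ms′∈ →
           walk l G G-periodic W W-zero W-suc n ms′ (≡.trans (length-increments ms ms′∈) |ms|≡l))) ⟩
    sumOver (allTuples l D) (λ js → term js ms) + sumOver (increments ms) (λ ms′ → sumOver (allTuples l D) (λ js → term js ms′))
      ≈⟨ +-congˡ (sum-swap (increments ms) (allTuples l D) _) ⟩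
    sumOver (allTuples l D) (λ js → term js ms) + sumOver (allTuples l D) (λ js → sumOver (increments ms) (λ ms′ → term js ms′))
      ≈⟨ sum-+ (allTuples l D) _ _ ⟨
    sumOver (allTuples l D) (λ js → term js ms + sumOver (increments ms) (λ ms′ → term js ms′))
      ≈⟨ sum-cong-∈ (allTuples l D) (λ js js∈ → combine js (≡.trans (proj₁ (∈-allTuples⁻ l D js∈)) (≡.sym |ms|≡l))) ⟩
    sumOver (allTuples l D) (λ js → (transform l G js * character (dual js) ms) * pow (1# + dualSum js) (suc n)) ∎
    where
    D^l = pow (castℕ D) l
    term : List ℕ → List ℕ → Carrier
    term js ms = (transform l G js * character (dual js) ms) * pow (1# + dualSum js) n
    combine : ∀ js → length js ≡ length ms → term js ms + sumOver (increments ms) (term js) ≈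
              (transform l G js * character (dual js) ms) * pow (1# + dualSum js) (suc n)
    combine js eq = begin
      term js ms + sumOver (increments ms) (term js)
        ≈⟨ +-congˡ (trans (sum-*ʳ P (increments ms) _) (*-congʳ (sum-*ˡ T (increments ms) _))) ⟩
      (T * c) * P + (T * sumOver (increments ms) (character (dual js))) * P
        ≈⟨ +-congˡ (*-congʳ (*-congˡ (character-increments js ms eq))) ⟩
      (T * c) * P + (T * (d * c)) * P
        ≈⟨ +-congʳ (*-congʳ (*-congˡ (*-identityˡ c))) ⟨
      (T * (1# * c)) * P + (T * (d * c)) * P
        ≈⟨ solve 5 (λ T c P d i → (T :* (i :* c)) :* P :+ (T :* (d :* c)) :* P := (T :* c) :* ((i :+ d) :* P)) refl T c P d 1# ⟩
      (T * c) * ((1# + d) * P) ∎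
      where
      T = transform l G js
      c = character (dual js) ms
      d = dualSum js
      P = pow (1# + d) n

-- Exponential sums

dot-ʳ++ : ∀ xs ys as bs → length xs ≡ length ys →
          ℕsum (zipWith ℕ._*_ (xs ʳ++ as) (ys ʳ++ bs)) ≡ ℕsum (zipWith ℕ._*_ xs ys) ℕ.+ ℕsum (zipWith ℕ._*_ as bs)
dot-ʳ++ []       []       as bs _  = ≡.refl
dot-ʳ++ (x ∷ xs) (y ∷ ys) as bs eq = begin
  ℕsum (zipWith ℕ._*_ (xs ʳ++ (x ∷ as)) (ys ʳ++ (y ∷ bs)))  ≡⟨ dot-ʳ++ xs ys (x ∷ as) (y ∷ bs) (ℕₚ.suc-injective eq) ⟩
  s ℕ.+ (x ℕ.* y ℕ.+ t)                                     ≡⟨ ℕₚ.+-assoc s (x ℕ.* y) t ⟨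
  s ℕ.+ x ℕ.* y ℕ.+ t                                       ≡⟨ ≡.cong (ℕ._+ t) (ℕₚ.+-comm s (x ℕ.* y)) ⟩
  x ℕ.* y ℕ.+ s ℕ.+ t                                       ∎
  where
  open ≡.≡-Reasoning
  s = ℕsum (zipWith ℕ._*_ xs ys)
  t = ℕsum (zipWith ℕ._*_ as bs)

dot-reverse : ∀ xs ys → length xs ≡ length ys →
              ℕsum (zipWith ℕ._*_ (reverse xs) (reverse ys)) ≡ ℕsum (zipWith ℕ._*_ xs ys)
dot-reverse xs ys eq = ≡.trans (dot-ʳ++ xs ys [] [] eq) (ℕₚ.+-identityʳ _)

-- Thus m⁺, which differs from m only by sending 0 to D, is invisible to D-periodic functions.
plus-% : ∀ D .{{_ : NonZero D}} m → plus D m % D ≡ m % D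
plus-% D zero    = ≡.trans (n%n≡0 D) (≡.sym (m*n%n≡0 0 D))
plus-% D (suc m) = ≡.refl

module Proof {p r : ℕ} (prime-p : Prime p) (1≤r : 1 ≤ r) (F : FiniteField p r)
             (k e : ℕ) (k<D : k < p ^ suc e)
             (K : Char0Domain) (root : PrimRoot K (p ^ suc e)) where
  open Thm F K e root k hiding (zero)
  open PrimRoot root using (ζ; ζ^D)

  instance
    D≢0 : NonZero (p ^ suc e)
    D≢0 = ℕₚ.m^n≢0 p (suc e) {{prime⇒nonZero prime-p}}

  open CommRing cring
  open Polynomials K
  open Fourier K D root
  import Relation.Binary.Reasoning.Setoid setoid as ≈-Reasoning
  private
    module F = FiniteField F
    module FF = FFOps F
    module FF₂ = FFOps2 F
    module FC = CommRing F.cring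
  open Series F.cring using (one#; linMul; linMul-cong; linMul-0#; gen; gen-zeros; gen-periodic; mulAll; mulAll-cong; mulAll-linMul)
    renaming (_≋_ to _≋F_)
  open FieldLemmas F

  N : ℕ
  N = q ∸ 1

  0<N : 0 < N
  0<N = ℕₚ.m<n⇒0<n∸m (ℕₚ.≤-trans (ℕ.nonTrivial⇒n>1 p {{prime⇒nonTrivial prime-p}})
    (≡.subst (_≤ p ^ r) (ℕₚ.*-identityʳ p) (ℕₚ.^-monoʳ-≤ p {{prime⇒nonZero prime-p}} 1≤r)))

  length-αs : length FF.αs ≡ N
  length-αs = ≡.trans (LP.length-map F.α (List.allFin N)) (LP.length-tabulate id)

  ψ-cong : ∀ {a b} → a F.≈ b → ψ a ≈ ψ b
  ψ-cong a≈b = reflexive (≡.cong (pow ξp) (toFp-cong (Tr-cong a≈b)))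

  -- H n L is Σ ψ([tᵏ] L(t) ∏ (1 + xᵢ t)) over x ∈ 𝔽_qⁿ
  H : ℕ → (ℕ → F.Carrier) → Carrier
  H n L = sumOver (FF.points n) (λ x → ψ (mulAll x L k))

  H-cong : ∀ n {L M} → L ≋F M → H n L ≈ H n M
  H-cong n L≋M = sum-cong (FF.points n) (λ x → ψ-cong (mulAll-cong x L≋M k))

  -- The first coordinate a is absorbed into the series as 1 + a t; for a = 0 this factor is 1.
  H-suc : ∀ n L → H (suc n) L ≈ H n L + sumOver FF.αs (λ a → H n (linMul a L))
  H-suc n L = begin
    H (suc n) L
      ≈⟨ sum-concatMap (λ a → map (a Vec.∷_) (FF.points n)) FF.elems _ ⟩
    sumOver FF.elems (λ a → sumOver (map (a Vec.∷_) (FF.points n)) (λ x → ψ (mulAll x L k)))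
      ≈⟨ sum-cong FF.elems (λ a → trans (reflexive (sum-map (a Vec.∷_) (FF.points n) _))
           (sum-cong (FF.points n) (λ x → ψ-cong (F.sym (mulAll-linMul x a L k))))) ⟩
    H n (linMul F.0# L) + sumOver FF.αs (λ a → H n (linMul a L))
      ≈⟨ +-congʳ (H-cong n (linMul-0# L)) ⟩
    H n L + sumOver FF.αs (λ a → H n (linMul a L)) ∎
    where open ≈-Reasoning

  G : List ℕ → Carrier
  G ms = ψ (gen FF.αs ms one# k)

  G-periodic : Periodic G
  G-periodic ms≡ns = ψ-cong (gen-periodic p prime-p F.charp (suc e) FF.αs ms≡ns (λ _ _ → F.refl) k k<D)

  -- Equivalently, mᵢ further coordinates are frozen at αᵢ while n coordinates vary.
  W : ℕ → List ℕ → Carrier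
  W n ms = H n (gen FF.αs ms one#)

  W-suc : ∀ n ms → length ms ≡ N → W (suc n) ms ≈ W n ms + sumOver (increments ms) (W n)
  W-suc n ms |ms|≡N = trans (H-suc n _)
    (+-congˡ (sum-increments F.cring cring (H n) (H-cong n) FF.αs ms one# (≡.trans length-αs (≡.sym |ms|≡N))))

  S≈W : ∀ n → S n ≈ W n (List.replicate N 0)
  S≈W n = sum-cong (FF.points n) λ x → ψ-cong
    (F.trans (esym≈mulAll k x) (mulAll-cong x (λ i → F.sym (gen-zeros FF.αs N one# i)) k))

  D^N : Carrier
  D^N = pow (castℕ D) N

  -- The walk starts from exponents 0, where every character equals 1.
  S-transform : ∀ n → D^N * S n ≈ sumOver (allTuples N D) (λ js → transform N G js * pow (baseNeg js) n)
  S-transform n = begin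
    D^N * S n
      ≈⟨ *-congˡ (S≈W n) ⟩
    D^N * W n zs
      ≈⟨ walk N G G-periodic W (λ ms → +-identityʳ _) W-suc n zs (LP.length-replicate N) ⟩
    sumOver (allTuples N D) (λ js → (transform N G js * character (dual js) zs) * pow (baseNeg js) n)
      ≈⟨ sum-cong (allTuples N D) (λ js → *-congʳ (trans (*-congˡ (character-zeros (dual js) N)) (*-identityʳ _))) ⟩
    sumOver (allTuples N D) (λ js → transform N G js * pow (baseNeg js) n) ∎
    where
    open ≈-Reasoning
    zs = List.replicate N 0

  Fp≈gen : ∀ bs → length bs ≡ N → FF₂.Fp D k bs F.≈ gen FF.αs bs one# k
  Fp≈gen bs |bs|≡N = F.trans (Λ≈gen FF.αs (map (plus D) bs) nonempty k)
    (gen-periodic p prime-p F.charp (suc e) FF.αs (periodic bs) (λ _ _ → F.refl) k k<D)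
    where
    periodic : ∀ bs → Pointwise (λ m n → m % D ≡ n % D) (map (plus D) bs) bs
    periodic []       = []
    periodic (b ∷ bs) = plus-% D b ∷ periodic bs
    nonempty : 0 < length (zipWith _,_ FF.αs (map (plus D) bs))
    nonempty = ≡.subst (0 <_) (≡.sym (≡.trans (LP.length-zipWith _,_ FF.αs (map (plus D) bs))
      (≡.trans (≡.cong₂ ℕ._⊓_ length-αs (≡.trans (LP.length-map (plus D) bs) |bs|≡N)) (ℕₚ.⊓-idem N)))) 0<N

  T : List ℕ → Carrier
  T js = sumOver (allTuples N D) (λ bs → ψ (FF₂.Fp D k bs) * character js (reverse bs))

  T-reverse : ∀ js → length js ≡ N → T (reverse js) ≈ transform N G js
  T-reverse js |js|≡N = sum-cong-∈ (allTuples N D) λ bs bs∈ →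
    let |bs|≡N = proj₁ (∈-allTuples⁻ N D bs∈) in
    *-cong (ψ-cong (Fp≈gen bs |bs|≡N))
           (reflexive (≡.cong (pow ζ) (dot-reverse js bs (≡.trans |js|≡N (≡.sym |bs|≡N)))))

  Dc≈ : ∀ js → Dc js ≈ sumOver (Sym js) T
  Dc≈ js = trans (sum-cong (allTuples N D) (λ bs → sym (sum-*ˡ _ (Sym js) _))) (sum-swap (allTuples N D) (Sym js) _)

  baseNeg-↭ : ∀ {js js′} → js ↭ js′ → baseNeg js ≈ baseNeg js′
  baseNeg-↭ p = +-congˡ (sum-↭ _ p)

  -- `baseNeg` is constant on each rearrangement class, so it moves inside the sum over `Sym`, and
  -- the classes together make up all tuples. Reversal then turns `T` into the transform.
  DRHS≈ : ∀ n → DRHS n ≈ sumOver (allTuples N D) (λ js → transform N G js * pow (baseNeg js) n)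
  DRHS≈ n = begin
    sumOver (decTuples N D) (λ js → Dc js * pow (baseNeg js) n)
      ≈⟨ sum-cong (decTuples N D) (λ js → trans (*-congʳ (Dc≈ js)) (sym (sum-*ʳ _ (Sym js) T))) ⟩
    sumOver (decTuples N D) (λ js → sumOver (Sym js) (λ js′ → T js′ * pow (baseNeg js) n))
      ≈⟨ sum-cong (decTuples N D) (λ js → sum-cong-∈ (Sym js) (λ js′ js′∈ →
           *-congˡ (pow-cong n (baseNeg-↭ (↭-sym (∈-Sym⁻ js js′∈)))))) ⟩
    sumOver (decTuples N D) (λ js → sumOver (Sym js) term)
      ≈⟨ sum-concatMap Sym (decTuples N D) term ⟨
    sumOver (concatMap Sym (decTuples N D)) term
      ≈⟨ sum-↭ term (Sym-decTuples↭allTuples N D) ⟩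
    sumOver (allTuples N D) term
      ≈⟨ sum-↭ term (reverse-allTuples↭ N D) ⟨
    sumOver (map reverse (allTuples N D)) term
      ≡⟨ sum-map reverse (allTuples N D) term ⟩
    sumOver (allTuples N D) (term ∘ reverse)
      ≈⟨ sum-cong-∈ (allTuples N D) (λ js js∈ → *-cong (T-reverse js (proj₁ (∈-allTuples⁻ N D js∈)))
           (pow-cong n (baseNeg-↭ (Permₚ.↭-reverse js)))) ⟩
    sumOver (allTuples N D) (λ js → transform N G js * pow (baseNeg js) n) ∎
    where
    open ≈-Reasoning
    term : List ℕ → Carrier
    term js = T js * pow (baseNeg js) n

  formula : ∀ n → D^N * S n ≈ DRHS n
  formula n = trans (S-transform n) (sym (DRHS≈ n))

  -- The characteristic polynomial: integer coefficients, roots, recurrence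

  mulLin≡lin : ∀ b cs → mulLin b cs ≡ lin b 0# cs
  mulLin≡lin b cs = go 0# cs
    where
    go : ∀ c ds → addCoeffs (c ∷ ds) (map (λ d → - (b * d)) ds) ≡ lin b c ds
    go c []       = ≡.refl
    go c (d ∷ ds) = ≡.cong (_ ∷_) (go d ds)

  P≡linProduct : P ≡ linProduct (map rootP (decTuples N D))
  P≡linProduct = ≡.trans (LP.foldr-cong (λ as cs → mulLin≡lin (rootP as) cs) ≡.refl (decTuples N D))
    (≡.sym (LP.foldr-map _ rootP _ (decTuples N D)))

  powers : List Carrier
  powers = map (pow ζ) (downFrom D)

  P≋sumProduct : P ≋ sumProduct N powers
  P≋sumProduct = ≡.subst (_≋ sumProduct N powers) (≡.sym P≡linProduct)
    (≡.subst (λ bs → linProduct bs ≋ sumProduct N powers) (≡.sym (LP.map-∘ (decTuples N D)))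
      (linProduct-↭ (translate-↭ 1# (↭ₛ (decTuples-sums (pow ζ) N D)))))
    where
    ↭ₛ = ↭⇒↭ₛ′ isEquivalence

  -- Xᵈ - 1, its leading coefficient being left implicit
  unityPolynomial : ∀ d → .{{NonZero d}} → Vec (Expr 0) d
  unityPolynomial (suc d) = neg one ∷ zeros d

  open Elimination K using (DistinctRoots; hornerMonic; evalAll)

  powers-roots : DistinctRoots (unityPolynomial D) powers
  powers-roots =
    AllPairsₚ.map⁺ (AllPairsₚ.applyDownFrom⁺₁ id D (λ j<i i<D → pow-≢⇒≉ i<D (ℕₚ.<-trans j<i i<D) (ℕₚ.<⇒≢ j<i ∘ ≡.sym))) ,
    Allₚ.map⁺ (All.universal (λ i → unity-root D (pow ζ i) (pow^D i)) _)
    where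
    hornerMonic-zeros : ∀ d y → hornerMonic (evalAll [] (zeros d)) y ≈ pow y d
    hornerMonic-zeros zero    y = refl
    hornerMonic-zeros (suc d) y = trans (+-identityˡ _) (*-congˡ (hornerMonic-zeros d y))
    unity-root : ∀ d .{{_ : NonZero d}} y → pow y d ≈ 1# → hornerMonic (evalAll [] (unityPolynomial d)) y ≈ 0#
    unity-root (suc d) y y^d≈1 =
      trans (+-congˡ (trans (*-congˡ (hornerMonic-zeros d y)) y^d≈1)) (-‿inverseˡ 1#)

  P-integer : All IntCoeff P
  P-integer = all-nth P λ i →
    let j , eq = sumProduct-integer (unityPolynomial D) N powers
                   (≡.trans (LP.length-map (pow ζ) (downFrom D)) (LP.length-downFrom D)) powers-roots i
    in j , trans (nth-≋ P≋sumProduct i) eq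
    where
    all-nth : ∀ cs → (∀ i → IntCoeff (nth 0# cs i)) → All IntCoeff cs
    all-nth []       int = []
    all-nth (c ∷ cs) int = int 0 ∷ all-nth cs (int ∘ suc)

  -- The exponents -j are reduced modulo D and sorted into a descending tuple, which indexes a
  -- linear factor of P with the same root.
  baseNeg-root : ∀ {js} → js ∈ decTuples N D → evalL P (baseNeg js) ≈ 0#
  baseNeg-root {js} js∈ with sort-decTuple N D negated-ok
    where
    negated-ok : IsTuple N D (map (λ j → (D ∸ j) % D) js)
    negated-ok = ≡.trans (LP.length-map _ js) (proj₁ (proj₁ (∈-decTuples⁻ N D js∈))) ,
                 Allₚ.map⁺ (All.universal (λ j → m%n<n (D ∸ j) D) js)
  ... | as , as∈ , negated↭as =
    trans (reflexive (≡.cong (λ cs → evalL cs (baseNeg js)) P≡linProduct))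
          (linProduct-root (map rootP (decTuples N D)) (∈-map⁺ rootP as∈) baseNeg≈rootP)
    where
    baseNeg≈rootP : baseNeg js ≈ rootP as
    baseNeg≈rootP = +-congˡ (begin
      sumOver js (λ j → pow ζ (D ∸ j))               ≈⟨ sum-cong js (λ j → pow-% (D ∸ j)) ⟩
      sumOver js (λ j → pow ζ ((D ∸ j) % D))         ≡⟨ sum-map (λ j → (D ∸ j) % D) js (pow ζ) ⟨
      sumOver (map (λ j → (D ∸ j) % D) js) (pow ζ)   ≈⟨ sum-↭ (pow ζ) negated↭as ⟩
      sumOver as (pow ζ)                             ∎)
      where open ≈-Reasoning

  pow≉0 : ∀ {x} → x ≉ 0# → ∀ n → pow x n ≉ 0#
  pow≉0 x≉0 zero    1≈0 = 0≉1 (sym 1≈0)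
  pow≉0 {x} x≉0 (suc n) eq with noZeroDiv x (pow x n) eq
  ... | inj₁ x≈0 = x≉0 x≈0
  ... | inj₂ p≈0 = pow≉0 x≉0 n p≈0

  castℕ≉0 : ∀ n → .{{NonZero n}} → castℕ n ≉ 0#
  castℕ≉0 (suc n) = char0 n

  -- Multiplied by D^N, the shifted sequence is a combination of geometric sequences in i whose
  -- ratios are roots of P, so P annihilates it; D^N is nonzero and cancels.
  recurrence : ∀ n → recAt S n
  recurrence n with noZeroDiv D^N (evalRec (λ i → S (n ℕ.+ i)) P) (begin
    D^N * evalRec (λ i → S (n ℕ.+ i)) P
      ≈⟨ evalRec-*ˡ D^N _ P ⟨
    evalRec (λ i → D^N * S (n ℕ.+ i)) P
      ≈⟨ evalRec-cong (λ i → trans (formula (n ℕ.+ i)) (sum-cong (decTuples N D) (λ js →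
           trans (*-congˡ (pow-+ (baseNeg js) n i)) (sym (*-assoc _ _ _))))) P ⟩
    evalRec (λ i → sumOver (decTuples N D) (λ js → (Dc js * pow (baseNeg js) n) * pow (baseNeg js) i)) P
      ≈⟨ evalRec-sum (decTuples N D) _ P ⟩
    sumOver (decTuples N D) (λ js → evalRec (λ i → (Dc js * pow (baseNeg js) n) * pow (baseNeg js) i) P)
      ≈⟨ sum-0 (decTuples N D) (λ js js∈ → trans (evalRec-geometric _ (baseNeg js) P)
           (trans (*-congˡ (baseNeg-root js∈)) (zeroʳ _))) ⟩
    0# ∎)
    where open ≈-Reasoning
  ... | inj₁ D^N≈0 = ⊥-elim (pow≉0 (castℕ≉0 D) N D^N≈0)
  ... | inj₂ rec≈0 = trans (reflexive (zipWith-upTo≡evalRec (λ i → S (n ℕ.+ i)) id P)) rec≈0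

theorem4p11 : (p r : ℕ) → Prime p → 1 ≤ r → (F : FiniteField p r)
    → (k e : ℕ) → 1 < k → p ^ e ≤ k → k < p ^ suc e
    → (K : Char0Domain) → (z : PrimRoot K (p ^ suc e))
    → let open Thm F K e z k in
    ((n : ℕ) → 1 ≤ n → pow (castℕ D) (q ∸ 1) * S n ≈ DRHS n)
    × All IntCoeff P
    × ((n : ℕ) → 1 ≤ n → recAt S n)
theorem4p11 p r prime-p 1≤r F k e _ _ k<D K z = (λ n _ → formula n) , P-integer , (λ n _ → recurrence n)
  where open Proof prime-p 1≤r F k e k<D K z
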